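{- $\mathcal L_{\mathsf{Eq}}\preceq_{exp}\mathcal L_{\mathsf{Canco}}\preceq_{exp}\mathcal L_{\mathsf{Hasco}}\preceq_{exp}\mathcal L_{\mathsf{Eq}}$, where for logics $\mathcal L_1,\mathcal L_2$ the relation $\mathcal L_1\preceq_{exp}\mathcal L_2$ means that for every closed formula $\phi\in\mathcal L_1$ there exists a closed formula $\phi'\in\mathcal L_2$ such that for every $TCCS^m$ process $P$, $P$ satisfies $\phi$ (in $\mathcal L_1$) if and only if $P$ satisfies $\phi'$ (in $\mathcal L_2$).
   Context: LANGUAGE. $\mathsf{Act}$ is an infinite set of actions with CCS complementation ($\bar{\bar a}=a$); $\tau\notin\mathsf{Act}$; $\mu$ ranges over $\mathsf{Act}\cup\{\tau\}$. Transaction names: $\mathsf{TrN}=\mathsf{inTrN}\uplus\mathsf{exTrN}$ (internal and external names, both infinite). Terms: $P,Q::=\sum_{i\in J}\mu_i.P_i$ ($J$ countable; $\mathbf 0$ is the empty sum) $\mid P\mid Q\mid\nu a.P\mid X\mid\mathrm{rec}X.P\mid[\![P\triangleright_kQ]\!]$ (running transaction named $k$) $\mid\mathrm{co}\mid[\![P\blacktriangleright Q]\!]$ (dormant transaction). $ftn(o)$ is the set of transaction names in $o$; $o\,\sharp\,o'$ means no transaction name of $o$ occurs in $o'$. A process is a well-formed term: (1) it is closed (no free process variables); (2) $ftn$ of it is finite; and for all subterms $[\![P_1\triangleright_kP_1']\!]$, $[\![P_2\blacktriangleright P_2']\!]$, $\sum\mu_i.Q_i$, $\mathrm{rec}X.R$: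 (3) $P_1,P_1',P_2,P_2',Q_i,R$ contain no transaction names; (4) $P_1,P_2,Q_i$ contain no dormant transactions; (5) $P_1,P_2$ are closed. PROCESS TRANSITIONS. $P\xrightarrow{\alpha}_\sigma Q$ with $\alpha\in\{a,\tau,k(\tau),k(a)\}$ and $\sigma$ a name substitution $\tilde k\mapsto l$ (domain the finite tuple $\tilde k$, possibly empty, range $\{l\}$; $\varepsilon$ alone is the empty substitution). Rules (symmetric ones omitted): - $\sum\mu_i.P_i\xrightarrow{\mu_j}_\varepsilon P_j$; - if $P\xrightarrow{a}_\varepsilon P'$ and $Q\xrightarrow{\bar a}_\varepsilon Q'$ then $P\mid Q\xrightarrow{\tau}_\varepsilon P'\mid Q'$; - $\mathrm{rec}X.P\xrightarrow{\tau}_\varepsilon P[\mathrm{rec}X.P/X]$; - if $\mu_j=a$ then $\sum\mu_i.P_i\xrightarrow{k(a)}_{\varepsilon\mapsto k}[\![P_j\mid\mathrm{co}\triangleright_k\sum\mu_i.P_i]\!]$; - if $P\xrightarrow{\mu}_\varepsilon P'$ and $k\,\sharp\,l$ then $[\![P\triangleright_lQ]\!]\xrightarrow{k(\mu)}_{l\mapsto k}[\![P'\triangleright_kQ]\!]$; - if $P\xrightarrow{k(a)}_{\sigma_1}P'$, $Q\xrightarrow{k(\bar a)}_{\sigma_2}Q'$, $\sigma_i=\tilde l_i\mapsto k$, then $P\mid Q\xrightarrow{k(\tau)}_{(\tilde l_1,\tilde l_2)\mapsto k}P'\sigma_2\mid Q'\sigma_1$; - if $P\xrightarrow{\alpha}_\sigma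 P'$ and $range(\sigma)\,\sharp\,Q$ then $P\mid Q\xrightarrow{\alpha}_\sigma P'\mid Q\sigma$; - if $P\xrightarrow{\alpha}_\sigma P'$ and $a$ does not occur in $\alpha$ then $\nu a.P\xrightarrow{\alpha}_\sigma\nu a.P'$. Reconfiguration transitions $P\xrightarrow{\beta}Q$, $\beta\in\{\mathrm{co}\,k,\mathrm{ab}\,k,\mathrm{new}\,k\}$ (symmetric rules omitted): - if $P\equiv\mathrm{co}\mid P''$ for some $P''$ and $P\rightsquigarrow_{\mathrm{co}}P'$ then $[\![P\triangleright_kQ]\!]\xrightarrow{\mathrm{co}\,k}P'$; - $[\![P\blacktriangleright Q]\!]\xrightarrow{\mathrm{new}\,k}[\![P\triangleright_kQ]\!]$; - $[\![P\triangleright_kQ]\!]\xrightarrow{\mathrm{ab}\,k}Q$; - for $\beta=\mathrm{co}\,k$ or $\mathrm{ab}\,k$: if $P\xrightarrow{\beta}P'$ and $Q\xrightarrow{\beta}Q'$ then $P\mid Q\xrightarrow{\beta}P'\mid Q'$; - if $P\xrightarrow{\beta}P'$ and $\beta\,\sharp\,Q$ then $P\mid Q\xrightarrow{\beta}P'\mid Q$; - if $P\xrightarrow{\beta}P'$ then $\nu a.P\xrightarrow{\beta}\nu a.P'$. Here $\equiv$ is standard CCS structural equivalence extended to transactions, and $\rightsquigarrow_{\mathrm{co}}$ is given by: $\mathrm{co}\rightsquigarrow_{\mathrm{co}}\mathbf 0$; sums, variables, $\mathrm{rec}X.P$ and $[\![P\blacktriangleright Q]\!]$ are related to themselves; it is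 compatible with $\nu a.-$ and $-\mid-$. EXTENDED CONFIGURATIONS. $I$ is a countable index set. An extended configuration is $\langle E;H\bullet P\rangle$ with $P$ a process, $E$ an equivalence relation over a finite subset of $\mathsf{TrN}$, and $H$ a finite partial function from $I$ to $\{k(a),k(\mathrm{ab}),k(\mathrm{co})\mid k\in\mathsf{exTrN},a\in\mathsf{Act}\}$. Let $H^{\mathrm{trn}}(i)$ be the name used in $H(i)$, $H^{\mathrm{trn}}$ the set of all these, and $\mathrm{Hasco}(H)=\{k\mid\exists i.\,H(i)=k(\mathrm{co})\}$. It is required that: (i) $H^{\mathrm{trn}}(i)=H^{\mathrm{trn}}(j)$ implies $i=j$; (ii) for $k\in\mathsf{exTrN}$, $k\,E\,k$ iff $k\in H^{\mathrm{trn}}$, and $k\,E\,k'$ implies ($k\in\mathrm{Hasco}(H)$ iff $k'\in\mathrm{Hasco}(H)$); (iii) $ftn(P)\cap\mathrm{Hasco}(H)=\emptyset$; (iv) $k\,E\,k'$ and $k,k'\in ftn(P)$ imply $k=k'$. Convention: external names of a configuration are those in its history, i.e. $ftn(P)\cap\mathsf{exTrN}\subseteq H^{\mathrm{trn}}$; in particular a process $P$ viewed as $\langle\emptyset;\varepsilon\bullet P\rangle$ ($\varepsilon$ the empty history) has $ftn(P)\subseteq\mathsf{inTrN}$. "$H,k(a)$" denotes $H$ extended at a new index. For $\sigma=\tilde k\mapsto l$, $\sigma(E)$ is the smallest equivalence relation $F\supseteq E$ with $l\,F\,l$ and $k\,F\,l$ for all $k\in dom(\sigma)$. $(E;H)\setminus_{\mathrm{co}}k$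 (resp. $\setminus_{\mathrm{ab}}k$) keeps $E$ and, for every $k'\,E\,k$, changes each $k'(a)$ in $H$ to $k'(\mathrm{co})$ (resp. $k'(\mathrm{ab})$). With $\Delta=E;H$, the extended transitions between extended configurations are: - $\langle\Delta\bullet P\rangle\xrightarrow{\tau}_e\langle\Delta\bullet Q\rangle$ if $P\xrightarrow{\tau}_\varepsilon Q$; - $\xrightarrow{\tau}_e\langle\sigma(E);H\bullet Q\rangle$ if $P\xrightarrow{k(\tau)}_\sigma Q$, $k\,\sharp\,E,H$, $k\in\mathsf{inTrN}$; - $\xrightarrow{\tau}_e\langle\Delta\bullet Q\rangle$ if $P\xrightarrow{\mathrm{new}\,k}Q$, $k\,\sharp\,\Delta$, $k\in\mathsf{inTrN}$; - $\xrightarrow{\tau}_e\langle\Delta\setminus_{\mathrm{co}}k\bullet Q\rangle$ if $P\xrightarrow{\mathrm{co}\,k}Q$; - $\xrightarrow{\tau}_e\langle\Delta\setminus_{\mathrm{ab}}k\bullet Q\rangle$ if $P\xrightarrow{\mathrm{ab}\,k}Q$; - $\xrightarrow{k(a)}_e\langle\sigma(E);H,k(a)\bullet Q\rangle$ if $P\xrightarrow{k(a)}_\sigma Q$, $k\,\sharp\,E,H$, $k\in\mathsf{exTrN}$; - $\xrightarrow{k(a)}_e\langle E,(k,k);H,k(\mathrm{ab})\bullet P\rangle$ if $k\,\sharp\,E,H,P$, $k\in\mathsf{exTrN}$. The commit-sensitive transitions $\xrightarrow{\zeta}_c$ are given by the same rules (with $_c$ for $_e$), except that the commit rule is replaced,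 with $E_{ext}(k)=\{k'\in\mathsf{exTrN}\mid k\,E\,k'\}$, by: $\langle\Delta\bullet P\rangle\xrightarrow{\mathrm{co}(E_{ext}(k))}_c\langle\Delta\setminus_{\mathrm{co}}k\bullet Q\rangle$ if $P\xrightarrow{\mathrm{co}\,k}Q$ and $E_{ext}(k)\neq\emptyset$; and $\langle\Delta\bullet P\rangle\xrightarrow{\tau}_c\langle\Delta\setminus_{\mathrm{co}}k\bullet Q\rangle$ if $P\xrightarrow{\mathrm{co}\,k}Q$ and $E_{ext}(k)=\emptyset$. For $s\in\{e,c\}$, $\stackrel{\tau}{\Rightarrow}_s$ is $(\xrightarrow{\tau}_s)^*$ and $\stackrel{\zeta}{\Rightarrow}_s$ is $\stackrel{\tau}{\Rightarrow}_s\xrightarrow{\zeta}_s\stackrel{\tau}{\Rightarrow}_s$ otherwise. LOGICS. $\mathsf{Var}$ is a countable set of variables disjoint from $\mathsf{exTrN}$. All three logics have formulae $\langle\tau\rangle\phi$, $\langle x(a)\rangle\phi$ ($x\in\mathsf{Var}$, bound in $\phi$; $a\in\mathsf{Act}$), $\neg\phi$, $\bigwedge_{i\in M}\phi_i$ ($M$ an arbitrary index set), plus: in $\mathcal L_{\mathsf{Hasco}}$, $\mathtt{Hasco}(v)$; in $\mathcal L_{\mathsf{Eq}}$, $v_1=_{\mathrm{co}}v_2$; in $\mathcal L_{\mathsf{Canco}}$, $\langle\mathrm{co}(K)\rangle\phi$ with $\emptyset\neq K\subseteq\mathsf{exTrN}\uplus\mathsf{Var}$; here $v,v_1,v_2\in\mathsf{exTrN}\cup\mathsf{Var}$.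 Closed formulae have no free variables. Satisfaction of closed formulae by extended configurations, with $s=e$ for $\mathcal L_{\mathsf{Hasco}},\mathcal L_{\mathsf{Eq}}$ and $s=c$ for $\mathcal L_{\mathsf{Canco}}$: $\mathcal C\models\langle\tau\rangle\phi$ iff $\mathcal C\stackrel{\tau}{\Rightarrow}_s\mathcal C'\models\phi$ for some $\mathcal C'$; $\mathcal C\models\langle x(a)\rangle\phi$ iff there is a cofinite $N\subseteq\mathsf{exTrN}$ such that for all $l\in N$ there is $\mathcal C'$ with $\mathcal C\stackrel{l(a)}{\Rightarrow}_s\mathcal C'$ and $\mathcal C'\models\phi[l/x]$; conjunction and negation are standard; and, for $\mathcal C=\langle E;H\bullet P\rangle$: $\mathcal C\models\mathtt{Hasco}(k)$ iff $k\in\mathrm{Hasco}(H)$; $\mathcal C\models k=_{\mathrm{co}}k'$ iff $k,k'\in\mathrm{Hasco}(H)$ and $k\,E\,k'$; $\mathcal C\models\langle\mathrm{co}(K)\rangle\phi$ iff $\mathcal C\stackrel{\mathrm{co}(K)}{\Rightarrow}_c\mathcal C'\models\phi$ for some $\mathcal C'$. A process $P$ satisfies $\phi$ iff $\langle\emptyset;\varepsilon\bullet P\rangle\models\phi$. -}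

module Defs where

open import Level using (0ℓ; Lift) renaming (suc to lsuc)
open import Data.Nat.Base using (ℕ; zero; suc)
open import Data.Fin.Base using (Fin; zero; suc; lift)
open import Data.Maybe.Base as Maybe using (Maybe; just; nothing)
open import Data.List.Base using (List; []; _∷_; _++_)
open import Data.List.Membership.Propositional using () renaming (_∈_ to _∈ˡ_; _∉_ to _∉ˡ_)
import Data.List.Membership.DecPropositional as DecMembership
open import Data.Vec.Base using (Vec; []; _∷_; lookup)
open import Data.Empty using (⊥; ⊥-elim)
open import Data.Unit.Base using (⊤)
open import Data.Product.Base using (Σ; ∃-syntax; _×_; _,_)
open import Data.Sum.Base using (_⊎_; inj₁; inj₂)
open import Data.Sum.Properties using (≡-dec)
open import Function.Base using (id; _∘_)
open import Function.Bundles using (_↣_; _↔_; _⇔_; Inverse; mk↣; mk⇔)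
open import Relation.Nullary.Negation.Core using (¬_)
open import Relation.Nullary.Decidable.Core using (yes; no)
open import Relation.Unary using (Pred; _∈_; _∉_; _≐_; Empty; Satisfiable)
open import Relation.Binary.Core using (Rel) renaming (_⇔_ to _⇔ʳ_)
open import Relation.Binary.Definitions using (DecidableEquality)
open import Relation.Binary.Structures using (IsPartialEquivalence)
open import Relation.Binary.PropositionalEquality using (_≡_; _≢_; _≗_; refl)
open import Relation.Binary.Construct.Closure.ReflexiveTransitive using (Star)

-- Some list covers the predicate.
Finite : ∀ {a ℓ} {A : Set a} → Pred A ℓ → Set _
Finite P = ∃[ xs ] ∀ x → x ∈ P → x ∈ˡ xs

-- The name sets the calculus is built over.  Channels are the base names of
-- CCS: an action is a channel or its co-name.  Decidable equality is only
-- needed to compute name substitutions.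
record Signature : Set₁ where
  field
    Chan inTrN exTrN I : Set
    Chan-infinite      : ℕ ↣ Chan
    inTrN-infinite     : ℕ ↣ inTrN
    exTrN-infinite     : ℕ ↣ exTrN
    I-countable        : I ↔ ℕ
    _≟in_              : DecidableEquality inTrN
    _≟ex_              : DecidableEquality exTrN

------------------------------------------------------------------------
-- Actions

data Act (A : Set) : Set where
  name coname : A → Act A

bar : ∀ {A : Set} → Act A → Act A
bar (name a)   = coname a
bar (coname a) = name a

data Pre (A : Set) : Set where
  τ   : Pre A
  act : Act A → Pre A

mapAct : ∀ {A B : Set} → (A → B) → Act A → Act B
mapAct f (name a)   = name (f a)
mapAct f (coname a) = coname (f a)

mapPre : ∀ {A B : Set} → (A → B) → Pre A → Pre B
mapPre f τ       = τ
mapPre f (act a) = act (mapAct f a)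

module TCCS (S : Signature) where
  open Signature S

  TrN : Set
  TrN = inTrN ⊎ exTrN

  pattern int k = inj₁ k
  pattern ext k = inj₂ k

  _≟TrN_ : DecidableEquality TrN
  _≟TrN_ = ≡-dec _≟in_ _≟ex_

  open DecMembership _≟TrN_ using (_∈?_)

------------------------------------------------------------------------
-- Terms

  -- Terms up to α-conversion.  Term A n has channels in A and free process
  -- variables in Fin n.  In ν P the bound channel is `nothing` and a channel
  -- a of the context is `just a`; in rec P the bound variable is `zero`.
  -- The index set of a sum is countable: it injects into ℕ.
  data Term (A : Set) (n : ℕ) : Set₁ where
    sum  : (J : Set) → J ↣ ℕ → (J → Pre A) → (J → Term A n) → Term A n
    _∣_  : Term A n → Term A n → Term A n
    ν    : Term (Maybe A) n → Term A n
    var  : Fin n → Term A n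
    rec  : Term A (suc n) → Term A n
    run  : Term A n → TrN → Term A n → Term A n   -- run P k Q  is  [[ P ▷ₖ Q ]]
    co   : Term A n
    dorm : Term A n → Term A n → Term A n         -- dorm P Q   is  [[ P ▶ Q ]]

  infixr 6 _∣_

  𝟎 : ∀ {A : Set} {n : ℕ} → Term A n
  𝟎 = sum ⊥ (mk↣ {to = λ ()} λ { {()} }) (λ ()) (λ ())

  ren : ∀ {A B : Set} {n m : ℕ} → (A → B) → (Fin n → Fin m) → Term A n → Term B m
  ren f g (sum J c μ P) = sum J c (λ i → mapPre f (μ i)) (λ i → ren f g (P i))
  ren f g (P ∣ Q)       = ren f g P ∣ ren f g Q
  ren f g (ν P)         = ν (ren (Maybe.map f) g P)
  ren f g (var x)       = var (g x)
  ren f g (rec P)       = rec (ren f (lift 1 g) P)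
  ren f g (run P k Q)   = run (ren f g P) k (ren f g Q)
  ren f g co            = co
  ren f g (dorm P Q)    = dorm (ren f g P) (ren f g Q)

  weaken : ∀ {A : Set} {n : ℕ} → Term A n → Term (Maybe A) n
  weaken = ren just id

  liftSub : ∀ {A : Set} {n m : ℕ} → (Fin n → Term A m) → Fin (suc n) → Term A (suc m)
  liftSub θ zero    = var zero
  liftSub θ (suc x) = ren id suc (θ x)

  sub : ∀ {A : Set} {n m : ℕ} → (Fin n → Term A m) → Term A n → Term A m
  sub θ (sum J c μ P) = sum J c μ (λ i → sub θ (P i))
  sub θ (P ∣ Q)       = sub θ P ∣ sub θ Q
  sub θ (ν P)         = ν (sub (λ x → weaken (θ x)) P)
  sub θ (var x)       = θ x
  sub θ (rec P)       = rec (sub (liftSub θ) P)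
  sub θ (run P k Q)   = run (sub θ P) k (sub θ Q)
  sub θ co            = co
  sub θ (dorm P Q)    = dorm (sub θ P) (sub θ Q)

  instantiate : ∀ {A : Set} {n : ℕ} → Term A n → Fin (suc n) → Term A n
  instantiate Q zero    = Q
  instantiate Q (suc x) = var x

  -- P [ Q ]  is  P[Q/X]
  _[_] : ∀ {A : Set} {n : ℕ} → Term A (suc n) → Term A n → Term A n
  P [ Q ] = sub (instantiate Q) P

  ftn : ∀ {A : Set} {n : ℕ} → Term A n → Pred TrN 0ℓ
  ftn (sum J c μ P) k = ∃[ i ] k ∈ ftn (P i)
  ftn (P ∣ Q)       k = k ∈ ftn P ⊎ k ∈ ftn Q
  ftn (ν P)         k = k ∈ ftn P
  ftn (var x)       k = ⊥
  ftn (rec P)       k = k ∈ ftn P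
  ftn (run P l Q)   k = k ≡ l ⊎ k ∈ ftn P ⊎ k ∈ ftn Q
  ftn co            k = ⊥
  ftn (dorm P Q)    k = k ∈ ftn P ⊎ k ∈ ftn Q

  NoNames : ∀ {A : Set} {n : ℕ} → Term A n → Set
  NoNames P = Empty (ftn P)

  NoDormant : ∀ {A : Set} {n : ℕ} → Term A n → Set
  NoDormant (sum J c μ P) = ∀ i → NoDormant (P i)
  NoDormant (P ∣ Q)       = NoDormant P × NoDormant Q
  NoDormant (ν P)         = NoDormant P
  NoDormant (var x)       = ⊤
  NoDormant (rec P)       = NoDormant P
  NoDormant (run P k Q)   = NoDormant P × NoDormant Q
  NoDormant co            = ⊤
  NoDormant (dorm P Q)    = ⊥

  fv : ∀ {A : Set} {n : ℕ} → Term A n → Pred (Fin n) 0ℓ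
  fv (sum J c μ P) x = ∃[ i ] x ∈ fv (P i)
  fv (P ∣ Q)       x = x ∈ fv P ⊎ x ∈ fv Q
  fv (ν P)         x = x ∈ fv P
  fv (var y)       x = x ≡ y
  fv (rec P)       x = suc x ∈ fv P
  fv (run P k Q)   x = x ∈ fv P ⊎ x ∈ fv Q
  fv co            x = ⊥
  fv (dorm P Q)    x = x ∈ fv P ⊎ x ∈ fv Q

  Closed : ∀ {A : Set} {n : ℕ} → Term A n → Set
  Closed P = Empty (fv P)

  -- The conditions on all subterms.
  WellFormed : ∀ {A : Set} {n : ℕ} → Term A n → Set
  WellFormed (sum J c μ P) = ∀ i → NoNames (P i) × NoDormant (P i) × WellFormed (P i)
  WellFormed (P ∣ Q)       = WellFormed P × WellFormed Q
  WellFormed (ν P)         = WellFormed P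
  WellFormed (var x)       = ⊤
  WellFormed (rec P)       = NoNames P × WellFormed P
  WellFormed (run P k Q)   = (NoNames P × NoDormant P × Closed P × WellFormed P)
                           × (NoNames Q × WellFormed Q)
  WellFormed co            = ⊤
  WellFormed (dorm P Q)    = (NoNames P × NoDormant P × Closed P × WellFormed P)
                           × (NoNames Q × WellFormed Q)

  record IsProcess (P : Term Chan 0) : Set where
    field
      closed     : Closed P
      ftn-finite : Finite (ftn P)
      wellFormed : WellFormed P

------------------------------------------------------------------------
-- Structural equivalence

  swap : ∀ {A : Set} → Maybe (Maybe A) → Maybe (Maybe A)
  swap nothing         = just nothing
  swap (just nothing)  = nothing
  swap (just (just a)) = just (just a)

  infix 4 _≡ₛ_

  data _≡ₛ_ {A : Set} {n : ℕ} : Term A n → Term A n → Set₁ where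
    ≡-refl      : ∀ {P} → P ≡ₛ P
    ≡-sym       : ∀ {P Q} → P ≡ₛ Q → Q ≡ₛ P
    ≡-trans     : ∀ {P Q R} → P ≡ₛ Q → Q ≡ₛ R → P ≡ₛ R
    sum-cong    : ∀ {J c μ μ′ P P′} → μ ≗ μ′ → (∀ i → P i ≡ₛ P′ i) →
                  sum J c μ P ≡ₛ sum J c μ′ P′
    ∣-cong      : ∀ {P P′ Q Q′} → P ≡ₛ P′ → Q ≡ₛ Q′ → P ∣ Q ≡ₛ P′ ∣ Q′
    ν-cong      : ∀ {P P′} → P ≡ₛ P′ → ν P ≡ₛ ν P′
    rec-cong    : ∀ {P P′} → P ≡ₛ P′ → rec P ≡ₛ rec P′
    run-cong    : ∀ {P P′ k Q Q′} → P ≡ₛ P′ → Q ≡ₛ Q′ → run P k Q ≡ₛ run P′ k Q′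
    dorm-cong   : ∀ {P P′ Q Q′} → P ≡ₛ P′ → Q ≡ₛ Q′ → dorm P Q ≡ₛ dorm P′ Q′
    sum-reindex : ∀ {J J′ c c′ μ P} (f : J′ ↔ J) →
                  sum J c μ P ≡ₛ sum J′ c′ (μ ∘ Inverse.to f) (P ∘ Inverse.to f)
    ∣-identity  : ∀ {P} → P ∣ 𝟎 ≡ₛ P
    ∣-comm      : ∀ {P Q} → P ∣ Q ≡ₛ Q ∣ P
    ∣-assoc     : ∀ {P Q R} → (P ∣ Q) ∣ R ≡ₛ P ∣ (Q ∣ R)
    ν-𝟎         : ν 𝟎 ≡ₛ 𝟎
    ν-swap      : ∀ {P} → ν (ν P) ≡ₛ ν (ν (ren swap id P))
    ν-extrude   : ∀ {P Q} → ν P ∣ Q ≡ₛ ν (P ∣ weaken Q)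

------------------------------------------------------------------------
-- Process transitions

  data Label (A : Set) : Set where
    plain : Pre A → Label A
    _⟨_⟩  : TrN → Pre A → Label A                 -- k(τ), k(a)

  mapLabel : ∀ {A B : Set} → (A → B) → Label A → Label B
  mapLabel f (plain μ) = plain (mapPre f μ)
  mapLabel f (k ⟨ μ ⟩) = k ⟨ mapPre f μ ⟩

  -- [] ↦ k has empty domain but range {k}, so it differs from ε.
  data TrSub : Set where
    ε   : TrSub
    _↦_ : List TrN → TrN → TrSub

  renameName : List TrN → TrN → TrN → TrN
  renameName ks l k with k ∈? ks
  ... | yes _ = l
  ... | no  _ = k

  renameTr : ∀ {A : Set} {n : ℕ} → List TrN → TrN → Term A n → Term A n
  renameTr ks l (sum J c μ P) = sum J c μ (λ i → renameTr ks l (P i))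
  renameTr ks l (P ∣ Q)       = renameTr ks l P ∣ renameTr ks l Q
  renameTr ks l (ν P)         = ν (renameTr ks l P)
  renameTr ks l (var x)       = var x
  renameTr ks l (rec P)       = rec (renameTr ks l P)
  renameTr ks l (run P k Q)   = run (renameTr ks l P) (renameName ks l k) (renameTr ks l Q)
  renameTr ks l co            = co
  renameTr ks l (dorm P Q)    = dorm (renameTr ks l P) (renameTr ks l Q)

  _⟦_⟧ : ∀ {A : Set} {n : ℕ} → Term A n → TrSub → Term A n
  P ⟦ ε ⟧      = P
  P ⟦ ks ↦ l ⟧ = renameTr ks l P

  range : TrSub → Pred TrN 0ℓ
  range ε        k = ⊥
  range (ks ↦ l) k = k ≡ l

  _♯ₜ_ : ∀ {A : Set} {n : ℕ} → Pred TrN 0ℓ → Term A n → Set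
  N ♯ₜ P = ∀ k → k ∈ N → k ∉ ftn P

  infix 4 _⟶⟨_⨟_⟩_

  data _⟶⟨_⨟_⟩_ {A : Set} {n : ℕ} : Term A n → Label A → TrSub → Term A n → Set₁ where

    sum-step : ∀ {J c μ P} (j : J) →
      sum J c μ P ⟶⟨ plain (μ j) ⨟ ε ⟩ P j

    comm : ∀ {P P′ Q Q′ a} →
      P ⟶⟨ plain (act a) ⨟ ε ⟩ P′ → Q ⟶⟨ plain (act (bar a)) ⨟ ε ⟩ Q′ →
      P ∣ Q ⟶⟨ plain τ ⨟ ε ⟩ P′ ∣ Q′

    unfold : ∀ {P} → rec P ⟶⟨ plain τ ⨟ ε ⟩ P [ rec P ]

    sum-embed : ∀ {J c μ P a k} (j : J) → μ j ≡ act a →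
      sum J c μ P ⟶⟨ k ⟨ act a ⟩ ⨟ [] ↦ k ⟩ run (P j ∣ co) k (sum J c μ P)

    run-step : ∀ {P P′ Q μ k l} →
      P ⟶⟨ plain μ ⨟ ε ⟩ P′ → k ≢ l →
      run P l Q ⟶⟨ k ⟨ μ ⟩ ⨟ (l ∷ []) ↦ k ⟩ run P′ k Q

    merge : ∀ {P P′ Q Q′ a k ls₁ ls₂} →
      P ⟶⟨ k ⟨ act a ⟩ ⨟ ls₁ ↦ k ⟩ P′ → Q ⟶⟨ k ⟨ act (bar a) ⟩ ⨟ ls₂ ↦ k ⟩ Q′ →
      P ∣ Q ⟶⟨ k ⟨ τ ⟩ ⨟ (ls₁ ++ ls₂) ↦ k ⟩ (P′ ⟦ ls₂ ↦ k ⟧) ∣ (Q′ ⟦ ls₁ ↦ k ⟧)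

    par-left : ∀ {P P′ Q α σ} →
      P ⟶⟨ α ⨟ σ ⟩ P′ → range σ ♯ₜ Q → P ∣ Q ⟶⟨ α ⨟ σ ⟩ P′ ∣ (Q ⟦ σ ⟧)

    par-right : ∀ {P Q Q′ α σ} →
      Q ⟶⟨ α ⨟ σ ⟩ Q′ → range σ ♯ₜ P → P ∣ Q ⟶⟨ α ⨟ σ ⟩ (P ⟦ σ ⟧) ∣ Q′

    -- A label of the form mapLabel just α does not mention the bound channel.
    res : ∀ {P P′ α σ} →
      P ⟶⟨ mapLabel just α ⨟ σ ⟩ P′ → ν P ⟶⟨ α ⨟ σ ⟩ ν P′

------------------------------------------------------------------------
-- Reconfiguration transitions

  infix 4 _⇝co_ _⟶ᵣ⟨_⟩_

  data _⇝co_ {A : Set} {n : ℕ} : Term A n → Term A n → Set₁ where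
    ⇝-co   : co ⇝co 𝟎
    ⇝-sum  : ∀ {J c μ P} → sum J c μ P ⇝co sum J c μ P
    ⇝-var  : ∀ {x} → var x ⇝co var x
    ⇝-rec  : ∀ {P} → rec P ⇝co rec P
    ⇝-dorm : ∀ {P Q} → dorm P Q ⇝co dorm P Q
    ⇝-ν    : ∀ {P P′} → P ⇝co P′ → ν P ⇝co ν P′
    ⇝-∣    : ∀ {P P′ Q Q′} → P ⇝co P′ → Q ⇝co Q′ → P ∣ Q ⇝co P′ ∣ Q′

  data Reconf : Set where
    commit abort new : TrN → Reconf

  nameOf : Reconf → TrN
  nameOf (commit k) = k
  nameOf (abort k)  = k
  nameOf (new k)    = k

  data _⟶ᵣ⟨_⟩_ {A : Set} {n : ℕ} : Term A n → Reconf → Term A n → Set₁ where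

    run-commit : ∀ {P P′ P″ k Q} → P ≡ₛ co ∣ P″ → P ⇝co P′ →
      run P k Q ⟶ᵣ⟨ commit k ⟩ P′

    dorm-new : ∀ {P k Q} → dorm P Q ⟶ᵣ⟨ new k ⟩ run P k Q

    run-abort : ∀ {P k Q} → run P k Q ⟶ᵣ⟨ abort k ⟩ Q

    par-commit : ∀ {P P′ Q Q′ k} →
      P ⟶ᵣ⟨ commit k ⟩ P′ → Q ⟶ᵣ⟨ commit k ⟩ Q′ → P ∣ Q ⟶ᵣ⟨ commit k ⟩ P′ ∣ Q′

    par-abort : ∀ {P P′ Q Q′ k} →
      P ⟶ᵣ⟨ abort k ⟩ P′ → Q ⟶ᵣ⟨ abort k ⟩ Q′ → P ∣ Q ⟶ᵣ⟨ abort k ⟩ P′ ∣ Q′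

    par-left : ∀ {P P′ Q β} →
      P ⟶ᵣ⟨ β ⟩ P′ → nameOf β ∉ ftn Q → P ∣ Q ⟶ᵣ⟨ β ⟩ P′ ∣ Q

    par-right : ∀ {P Q Q′ β} →
      Q ⟶ᵣ⟨ β ⟩ Q′ → nameOf β ∉ ftn P → P ∣ Q ⟶ᵣ⟨ β ⟩ P ∣ Q′

    res : ∀ {P P′ β} → P ⟶ᵣ⟨ β ⟩ P′ → ν P ⟶ᵣ⟨ β ⟩ ν P′

------------------------------------------------------------------------
-- Extended configurations

  data Status : Set where
    acted     : Act Chan → Status                 -- k(a)
    aborted   : Status                            -- k(ab)
    committed : Status                            -- k(co)

  History : Set
  History = I → Maybe (exTrN × Status)

  Hᵗʳⁿ : History → Pred exTrN 0ℓ
  Hᵗʳⁿ H k = ∃[ i ] ∃[ s ] H i ≡ just (k , s)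

  Hasco : History → Pred exTrN 0ℓ
  Hasco H k = ∃[ i ] H i ≡ just (k , committed)

  -- An equivalence relation over a finite subset of TrN is a partial
  -- equivalence on TrN whose domain {k | k E k} is finite.
  record Config : Set₁ where
    field
      E           : Rel TrN 0ℓ
      H           : History
      proc        : Term Chan 0
      isProcess   : IsProcess proc
      E-per       : IsPartialEquivalence E
      E-finite    : Finite (λ k → E k k)
      H-finite    : Finite (λ i → H i ≢ nothing)
      H-unique    : ∀ {i j k s t} → H i ≡ just (k , s) → H j ≡ just (k , t) → i ≡ j
      E-H         : ∀ k → E (ext k) (ext k) ⇔ k ∈ Hᵗʳⁿ H
      -- Only external names occur in H, so k and k′ are both external here.
      E-Hasco     : ∀ {k k′} → E (ext k) (ext k′) → k ∈ Hasco H ⇔ k′ ∈ Hasco H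
      ftn-Hasco   : ∀ {k} → ext k ∈ ftn proc → k ∉ Hasco H
      E-ftn       : ∀ {k k′} → E k k′ → k ∈ ftn proc → k′ ∈ ftn proc → k ≡ k′
      ftn-ext     : ∀ {k} → ext k ∈ ftn proc → k ∈ Hᵗʳⁿ H

  open Config

  -- σ(E)
  data _⦅_⦆ (σ : TrSub) (E : Rel TrN 0ℓ) : Rel TrN 0ℓ where
    base  : ∀ {k k′} → E k k′ → (σ ⦅ E ⦆) k k′
    rng   : ∀ {ks l} → σ ≡ ks ↦ l → (σ ⦅ E ⦆) l l
    dom   : ∀ {ks l k} → σ ≡ ks ↦ l → k ∈ˡ ks → (σ ⦅ E ⦆) k l
    sym   : ∀ {k k′} → (σ ⦅ E ⦆) k k′ → (σ ⦅ E ⦆) k′ k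
    trans : ∀ {k k′ k″} → (σ ⦅ E ⦆) k k′ → (σ ⦅ E ⦆) k′ k″ → (σ ⦅ E ⦆) k k″

  -- E,(k,k)
  _,,_ : Rel TrN 0ℓ → TrN → Rel TrN 0ℓ
  (E ,, k) x y = E x y ⊎ (x ≡ k × y ≡ k)

  -- Extends H (k , s) H′  :  H′ is  H,k(s)
  Extends : History → exTrN × Status → History → Set
  Extends H h H′ = ∃[ i ] H i ≡ nothing × H′ i ≡ just h × (∀ j → j ≢ i → H′ j ≡ H j)

  -- How one entry of the history changes when every k′(a) with k′ in N
  -- becomes k′(s).
  data Update (N : Pred exTrN 0ℓ) (s : Status) : Rel (Maybe (exTrN × Status)) 0ℓ where
    undefined : Update N s nothing nothing
    affected  : ∀ {k a} → k ∈ N → Update N s (just (k , acted a)) (just (k , s))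
    spared    : ∀ {k a} → k ∉ N → Update N s (just (k , acted a)) (just (k , acted a))
    aborted   : ∀ {k} → Update N s (just (k , aborted)) (just (k , aborted))
    committed : ∀ {k} → Update N s (just (k , committed)) (just (k , committed))

  -- E_ext(k)
  Eext : Rel TrN 0ℓ → TrN → Pred exTrN 0ℓ
  Eext E k k′ = E k (ext k′)

  -- The Δ-component of the second configuration is that of the first, resp.
  -- that of the first with the transaction of k resolved to s.  Relations and
  -- histories are compared extensionally.
  SameΔ : Config → Config → Set
  SameΔ C C′ = E C′ ⇔ʳ E C × H C′ ≗ H C

  Resolve : Status → TrN → Config → Config → Set
  Resolve s k C C′ = E C′ ⇔ʳ E C × (∀ i → Update (Eext (E C) k) s (H C i) (H C′ i))

  -- k ♯ E,H
  _♯Δ_ : TrN → Config → Set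
  k ♯Δ C = (∀ k′ → ¬ E C k k′) × (∀ l → l ∈ Hᵗʳⁿ (H C) → k ≢ ext l)

------------------------------------------------------------------------
-- Extended and commit-sensitive transitions

  data Sem : Set where
    e c : Sem

  data Obs : Set₁ where
    τ    : Obs
    _⟨_⟩ : exTrN → Act Chan → Obs
    co   : Pred exTrN 0ℓ → Obs

  data _—[_]→⟨_⟩_ (C : Config) : Obs → Sem → Config → Set₁ where

    silent : ∀ {s C′} →
      proc C ⟶⟨ plain τ ⨟ ε ⟩ proc C′ → SameΔ C C′ →
      C —[ τ ]→⟨ s ⟩ C′

    internal : ∀ {s C′ k σ} →
      proc C ⟶⟨ int k ⟨ τ ⟩ ⨟ σ ⟩ proc C′ → int k ♯Δ C →
      E C′ ⇔ʳ (σ ⦅ E C ⦆) → H C′ ≗ H C →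
      C —[ τ ]→⟨ s ⟩ C′

    activate : ∀ {s C′ k} →
      proc C ⟶ᵣ⟨ new (int k) ⟩ proc C′ → int k ♯Δ C → SameΔ C C′ →
      C —[ τ ]→⟨ s ⟩ C′

    abort : ∀ {s C′ k} →
      proc C ⟶ᵣ⟨ abort k ⟩ proc C′ → Resolve aborted k C C′ →
      C —[ τ ]→⟨ s ⟩ C′

    visible : ∀ {s C′ k a σ} →
      proc C ⟶⟨ ext k ⟨ act a ⟩ ⨟ σ ⟩ proc C′ → ext k ♯Δ C →
      E C′ ⇔ʳ (σ ⦅ E C ⦆) → Extends (H C) (k , acted a) (H C′) →
      C —[ k ⟨ a ⟩ ]→⟨ s ⟩ C′

    ignored : ∀ {s C′ k a} →
      proc C′ ≡ proc C → ext k ♯Δ C → ext k ∉ ftn (proc C) →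
      E C′ ⇔ʳ (E C ,, ext k) → Extends (H C) (k , aborted) (H C′) →
      C —[ k ⟨ a ⟩ ]→⟨ s ⟩ C′

    commit-e : ∀ {C′ k} →
      proc C ⟶ᵣ⟨ commit k ⟩ proc C′ → Resolve committed k C C′ →
      C —[ τ ]→⟨ e ⟩ C′

    commit-c : ∀ {C′ k K} →
      proc C ⟶ᵣ⟨ commit k ⟩ proc C′ → Resolve committed k C C′ →
      Satisfiable (Eext (E C) k) → K ≐ Eext (E C) k →
      C —[ co K ]→⟨ c ⟩ C′

    commit-τ : ∀ {C′ k} →
      proc C ⟶ᵣ⟨ commit k ⟩ proc C′ → Resolve committed k C C′ →
      Empty (Eext (E C) k) →
      C —[ τ ]→⟨ c ⟩ C′

  _=[τ]⇒⟨_⟩_ : Config → Sem → Config → Set₁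
  C =[τ]⇒⟨ s ⟩ C′ = Star (λ D D′ → D —[ τ ]→⟨ s ⟩ D′) C C′

  _=[_]⇒⟨_⟩_ : Config → Obs → Sem → Config → Set₁
  C =[ τ ]⇒⟨ s ⟩ C′ = C =[τ]⇒⟨ s ⟩ C′
  C =[ ζ ]⇒⟨ s ⟩ C′ =
    ∃[ D ] ∃[ D′ ] C =[τ]⇒⟨ s ⟩ D × D —[ ζ ]→⟨ s ⟩ D′ × D′ =[τ]⇒⟨ s ⟩ C′

------------------------------------------------------------------------
-- Logics

  data Logic : Set where
    ℒHasco ℒEq ℒCanco : Logic

  -- Names and variables, with n variables in scope.
  NV : ℕ → Set
  NV n = exTrN ⊎ Fin n

  -- Formulae up to renaming of bound variables, with free variables in Fin n;
  -- in ⟨x⟨ a ⟩⟩ φ the bound variable x is `zero`.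
  data Formula : Logic → ℕ → Set₁ where
    ⟨τ⟩_      : ∀ {ℒ n} → Formula ℒ n → Formula ℒ n
    ⟨x⟨_⟩⟩_   : ∀ {ℒ n} → Act Chan → Formula ℒ (suc n) → Formula ℒ n
    ∼_        : ∀ {ℒ n} → Formula ℒ n → Formula ℒ n
    ⋀         : ∀ {ℒ n} (M : Set) → (M → Formula ℒ n) → Formula ℒ n
    hasco     : ∀ {n} → NV n → Formula ℒHasco n
    _=co_     : ∀ {n} → NV n → NV n → Formula ℒEq n
    ⟨co_∣_⟩_  : ∀ {n} (K : Pred (NV n) 0ℓ) → Satisfiable K → Formula ℒCanco n →
                Formula ℒCanco n

  sem : Logic → Sem
  sem ℒHasco = e
  sem ℒEq    = e
  sem ℒCanco = c

  value : ∀ {n} → Vec exTrN n → NV n → exTrN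
  value ρ (inj₁ k) = k
  value ρ (inj₂ x) = lookup ρ x

  valueₛ : ∀ {n} → Vec exTrN n → Pred (NV n) 0ℓ → Pred exTrN 0ℓ
  valueₛ ρ K k = ∃[ v ] v ∈ K × value ρ v ≡ k

  -- C ⊨[ ρ ] φ  is satisfaction of the closed formula obtained from φ by
  -- substituting the names ρ for its variables; the substitution φ[l/x] is
  -- recorded by extending ρ with l.  A cofinite set of external names is given
  -- by the finite list of names it excludes.
  _⊨[_]_ : ∀ {ℒ n} → Config → Vec exTrN n → Formula ℒ n → Set₁
  _⊨[_]_ {ℒ} C ρ (⟨τ⟩ φ) = ∃[ C′ ] C =[ τ ]⇒⟨ sem ℒ ⟩ C′ × C′ ⊨[ ρ ] φ
  _⊨[_]_ {ℒ} C ρ (⟨x⟨ a ⟩⟩ φ) =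
    Σ (List exTrN) λ excluded → ∀ l → l ∉ˡ excluded →
      ∃[ C′ ] C =[ l ⟨ a ⟩ ]⇒⟨ sem ℒ ⟩ C′ × C′ ⊨[ l ∷ ρ ] φ
  C ⊨[ ρ ] (∼ φ) = ¬ (C ⊨[ ρ ] φ)
  C ⊨[ ρ ] (⋀ M φ) = ∀ (i : M) → C ⊨[ ρ ] φ i
  C ⊨[ ρ ] (hasco v) = Lift (lsuc 0ℓ) (value ρ v ∈ Hasco (H C))
  C ⊨[ ρ ] (v =co w) = Lift (lsuc 0ℓ)
    ((value ρ v ∈ Hasco (H C) × value ρ w ∈ Hasco (H C)) ×
     E C (ext (value ρ v)) (ext (value ρ w)))
  C ⊨[ ρ ] (⟨co K ∣ _ ⟩ φ) = ∃[ C′ ] C =[ co (valueₛ ρ K) ]⇒⟨ c ⟩ C′ × C′ ⊨[ ρ ] φ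

  ClosedFormula : Logic → Set₁
  ClosedFormula ℒ = Formula ℒ 0

  -- A process on its own has no history, hence no external names.
  record Process : Set₁ where
    field
      term          : Term Chan 0
      isProcess     : IsProcess term
      internal-only : ∀ k → ext k ∉ ftn term

  ⟨∅⨟ε•_⟩ : Process → Config
  ⟨∅⨟ε• P ⟩ = record
    { E         = λ _ _ → ⊥
    ; H         = λ _ → nothing
    ; proc      = term P
    ; isProcess = isProcess P
    ; E-per     = record { sym = λ () ; trans = λ () }
    ; E-finite  = [] , λ _ ()
    ; H-finite  = [] , λ _ ≢nothing → ⊥-elim (≢nothing refl)
    ; H-unique  = λ ()
    ; E-H       = λ _ → mk⇔ (λ ()) (λ ())
    ; E-Hasco   = λ ()
    ; ftn-Hasco = λ { _ (_ , ()) }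
    ; E-ftn     = λ ()
    ; ftn-ext   = λ {k} k∈ → ⊥-elim (internal-only P k k∈)
    }
    where open Process

  infix 4 _⊨_ _≼exp_

  _⊨_ : ∀ {ℒ} → Process → ClosedFormula ℒ → Set₁
  P ⊨ φ = ⟨∅⨟ε• P ⟩ ⊨[ [] ] φ

  _≼exp_ : Logic → Logic → Set₁
  ℒ₁ ≼exp ℒ₂ = ∀ (φ : ClosedFormula ℒ₁) →
    Σ (ClosedFormula ℒ₂) λ φ′ → ∀ (P : Process) → P ⊨ φ ⇔ P ⊨ φ′

{-# OPTIONS --safe #-}

-- The transition relations →e and →c differ only in whether commits of external names are observed.
-- Along a run from a process, the names in the history are the values of the variables in scope,
-- so the possible commits are those of sets of variables.
--
-- From ℒEq to ℒCanco, an e-run is a sequence of observed commits with silent c-runs in between, and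
-- the disjunction over all such sequences makes the relation =co known at each subformula.  From
-- ℒCanco to ℒHasco, a c-run is an e-run along which the set of committed names stays the same.  A
-- commit of K can be recognised because E only grows and history entries related by E are committed
-- together: the configuration just before it has no run that commits only a part of K.  From ℒHasco
-- to ℒEq, Hasco(v) is v =co v.
--
-- External names in formulas are eliminated beforehand.  This rests on equivariance of transitions
-- and satisfaction under transpositions of external names.
module Submission where

open import Level using (0ℓ; Lift; lift; lower) renaming (suc to lsuc)
open import Axiom.ExcludedMiddle using (ExcludedMiddle)
open import Data.Bool.Base using (Bool; true; false; if_then_else_; T)
open import Data.Nat.Base using (ℕ; suc)
open import Data.Fin.Base as Fin using (Fin; zero; suc)
open import Data.Maybe.Base as Maybe using (Maybe; just; nothing)
open import Data.List.Base using (List; []; _∷_; _++_; map; tabulate)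
open import Data.List.Properties using (map-++)
open import Data.List.Membership.Propositional using () renaming (_∈_ to _∈ˡ_; _∉_ to _∉ˡ_)
open import Data.List.Membership.Propositional.Properties
  using (∈-map⁺; ∈-map⁻; ∈-++⁺ˡ; ∈-++⁺ʳ; ∈-++⁻; ∈-tabulate⁺; finite)
import Data.List.Membership.DecPropositional as DecMembership
open import Data.List.Relation.Unary.Any using (here)
open import Data.Vec.Base using (Vec; []; _∷_; lookup)
open import Data.Empty using (⊥; ⊥-elim)
open import Data.Product.Base using (Σ; ∃-syntax; _×_; _,_; proj₁; proj₂; map₁)
open import Data.Sum.Base as Sum using (_⊎_; inj₁; inj₂; map₂)
open import Function.Base using (id; _∘_)
open import Function.Bundles using (Inverse; _⇔_; Equivalence; mk⇔)
open import Function.Construct.Composition using (_⇔-∘_)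
open import Relation.Nullary.Decidable
  using (yes; no; map′; isYes; toWitness; fromWitness; decidable-stable)
open import Relation.Nullary.Negation.Core using (¬_; contradiction)
open import Relation.Unary using (Pred; _∈_; _∉_; _⊆_; _≐_; _∪_; ∅; Satisfiable)
open import Relation.Binary.Core using (Rel) renaming (_⇔_ to _⇔ʳ_)
open import Relation.Binary.Structures using (IsPartialEquivalence)
open import Relation.Binary.Construct.Closure.ReflexiveTransitive
  using (_◅_; _◅◅_) renaming (ε to [])
open import Relation.Binary.PropositionalEquality as ≡
  using (_≡_; _≢_; refl; cong; subst; subst₂)
open import Defs

-- `ℒCanco` has no atomic formulae, so a formula of it cannot test which names are committed; the
-- translations therefore carry the commit state (`R` or `A`) as an argument and recompute it at
-- each modality. Two obstacles shape the rest. Under `⟨x⟨ a ⟩⟩` the commits that precede the action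
-- may differ from name to name, while a disjunction over them has to stand outside the modality;
-- this is resolved by showing that a single fresh name decides the modality. Moreover, the
-- conditions on configurations do not exclude a name that occurs in the process although its
-- history entry is already aborted; a commit of such a name would be observed without making the
-- name `committed`. The invariant `Sound` rules this out. Excluded middle is taken at the universe
-- level of satisfaction, because disjunction is encoded through negation.

module Formulae (S : Signature) where
  open Signature S
  open TCCS S

  -- Formulae without external names

  data Pure : Logic → ℕ → Set₁ where
    ⟨τ⟩_      : ∀ {ℒ n} → Pure ℒ n → Pure ℒ n
    ⟨x⟨_⟩⟩_   : ∀ {ℒ n} → Act Chan → Pure ℒ (suc n) → Pure ℒ n
    ∼_        : ∀ {ℒ n} → Pure ℒ n → Pure ℒ n
    ⋀         : ∀ {ℒ n} (M : Set) → (M → Pure ℒ n) → Pure ℒ n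
    hasco     : ∀ {n} → Fin n → Pure ℒHasco n
    _=co_     : ∀ {n} → Fin n → Fin n → Pure ℒEq n
    ⟨co_∣_⟩_  : ∀ {n} (K : Pred (Fin n) 0ℓ) → Satisfiable K → Pure ℒCanco n → Pure ℒCanco n

  vars : ∀ {n} → Pred (Fin n) 0ℓ → Pred (NV n) 0ℓ
  vars K (inj₁ k) = ⊥
  vars K (inj₂ x) = x ∈ K

  ⌊_⌋ : ∀ {ℒ n} → Pure ℒ n → Formula ℒ n
  ⌊ ⟨τ⟩ φ ⌋           = ⟨τ⟩ ⌊ φ ⌋
  ⌊ ⟨x⟨ a ⟩⟩ φ ⌋      = ⟨x⟨ a ⟩⟩ ⌊ φ ⌋
  ⌊ ∼ φ ⌋             = ∼ ⌊ φ ⌋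
  ⌊ ⋀ M φ ⌋           = ⋀ M (λ i → ⌊ φ i ⌋)
  ⌊ hasco x ⌋         = hasco (inj₂ x)
  ⌊ x =co y ⌋         = inj₂ x =co inj₂ y
  ⌊ ⟨co K ∣ x , x∈ ⟩ φ ⌋ = ⟨co vars K ∣ inj₂ x , x∈ ⟩ ⌊ φ ⌋

-- Equivariance under an involution of the external names

module Renaming (S : Signature) (f : Signature.exTrN S → Signature.exTrN S)
                (f-involutive : ∀ k → f (f k) ≡ k) where
  open Signature S
  open TCCS S
  open Config
  open Formulae S
  open DecMembership _≟TrN_ using (_∈?_)

  π : TrN → TrN
  π = map₂ f

  π-involutive : ∀ k → π (π k) ≡ k
  π-involutive (int k) = refl
  π-involutive (ext k) = cong ext (f-involutive k)

  π-injective : ∀ {k l} → π k ≡ π l → k ≡ l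
  π-injective {k} {l} eq = ≡.trans (≡.sym (π-involutive k)) (≡.trans (cong π eq) (π-involutive l))

  -- A relation rather than a function on terms: sums contain functions, so without extensionality
  -- renaming commutes with substitution only up to this relation.
  infix 4 _≃_

  data _≃_ {A : Set} {n : ℕ} : Term A n → Term A n → Set₁ where
    sum  : ∀ {J ι μ P Q} → (∀ i → P i ≃ Q i) → sum J ι μ P ≃ sum J ι μ Q
    _∣_  : ∀ {P P′ Q Q′} → P ≃ P′ → Q ≃ Q′ → P ∣ Q ≃ P′ ∣ Q′
    ν    : ∀ {P P′} → P ≃ P′ → ν P ≃ ν P′
    var  : ∀ {x} → var x ≃ var x
    rec  : ∀ {P P′} → P ≃ P′ → rec P ≃ rec P′
    run  : ∀ {P P′ k k′ Q Q′} → P ≃ P′ → k′ ≡ π k → Q ≃ Q′ → run P k Q ≃ run P′ k′ Q′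
    co   : co ≃ co
    dorm : ∀ {P P′ Q Q′} → P ≃ P′ → Q ≃ Q′ → dorm P Q ≃ dorm P′ Q′

  image : ∀ {A n} → Term A n → Term A n
  image (sum J ι μ P) = sum J ι μ (λ i → image (P i))
  image (P ∣ Q)       = image P ∣ image Q
  image (ν P)         = ν (image P)
  image (var x)       = var x
  image (rec P)       = rec (image P)
  image (run P k Q)   = run (image P) (π k) (image Q)
  image co            = co
  image (dorm P Q)    = dorm (image P) (image Q)

  ≃-image : ∀ {A n} (P : Term A n) → P ≃ image P
  ≃-image (sum J ι μ P) = sum (λ i → ≃-image (P i))
  ≃-image (P ∣ Q)       = ≃-image P ∣ ≃-image Q
  ≃-image (ν P)         = ν (≃-image P)
  ≃-image (var x)       = var
  ≃-image (rec P)       = rec (≃-image P)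
  ≃-image (run P k Q)   = run (≃-image P) refl (≃-image Q)
  ≃-image co            = co
  ≃-image (dorm P Q)    = dorm (≃-image P) (≃-image Q)

  ≃-sym : ∀ {A n} {P Q : Term A n} → P ≃ Q → Q ≃ P
  ≃-sym (sum p)        = sum (λ i → ≃-sym (p i))
  ≃-sym (p ∣ q)        = ≃-sym p ∣ ≃-sym q
  ≃-sym (ν p)          = ν (≃-sym p)
  ≃-sym var            = var
  ≃-sym (rec p)        = rec (≃-sym p)
  ≃-sym (run p refl q) = run (≃-sym p) (≡.sym (π-involutive _)) (≃-sym q)
  ≃-sym co             = co
  ≃-sym (dorm p q)     = dorm (≃-sym p) (≃-sym q)

  ≃-refl : ∀ {A n} (P : Term A n) → (∀ {k} → k ∈ ftn P → π k ≡ k) → P ≃ P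
  ≃-refl (sum J ι μ P) fix = sum (λ i → ≃-refl (P i) (λ k∈ → fix (i , k∈)))
  ≃-refl (P ∣ Q)       fix = ≃-refl P (fix ∘ inj₁) ∣ ≃-refl Q (fix ∘ inj₂)
  ≃-refl (ν P)         fix = ν (≃-refl P fix)
  ≃-refl (var x)       fix = var
  ≃-refl (rec P)       fix = rec (≃-refl P fix)
  ≃-refl (run P k Q)   fix = run (≃-refl P (fix ∘ inj₂ ∘ inj₁)) (≡.sym (fix (inj₁ refl)))
                                 (≃-refl Q (fix ∘ inj₂ ∘ inj₂))
  ≃-refl co            fix = co
  ≃-refl (dorm P Q)    fix = dorm (≃-refl P (fix ∘ inj₁)) (≃-refl Q (fix ∘ inj₂))

  ≃-ftn : ∀ {A n} {P Q : Term A n} → P ≃ Q → ∀ {k} → k ∈ ftn P → π k ∈ ftn Q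
  ≃-ftn (sum p) (i , k∈)             = i , ≃-ftn (p i) k∈
  ≃-ftn (p ∣ q)                      = Sum.map (≃-ftn p) (≃-ftn q)
  ≃-ftn (ν p)                        = ≃-ftn p
  ≃-ftn (rec p)                      = ≃-ftn p
  ≃-ftn (run p refl q) (inj₁ refl)   = inj₁ refl
  ≃-ftn (run p eq q)   (inj₂ k∈)     = inj₂ (Sum.map (≃-ftn p) (≃-ftn q) k∈)
  ≃-ftn (dorm p q)                   = Sum.map (≃-ftn p) (≃-ftn q)

  ≃-ftn⁻ : ∀ {A n} {P Q : Term A n} → P ≃ Q → ∀ {k} → π k ∈ ftn Q → k ∈ ftn P
  ≃-ftn⁻ {P = P} p {k} k∈ = subst (_∈ ftn P) (π-involutive k) (≃-ftn (≃-sym p) k∈)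

  ≃-NoNames : ∀ {A n} {P Q : Term A n} → P ≃ Q → NoNames P → NoNames Q
  ≃-NoNames p none k k∈ = none (π k) (≃-ftn (≃-sym p) k∈)

  ≃-fv : ∀ {A n} {P Q : Term A n} → P ≃ Q → ∀ {x} → x ∈ fv P → x ∈ fv Q
  ≃-fv (sum p) (i , x∈) = i , ≃-fv (p i) x∈
  ≃-fv (p ∣ q)          = Sum.map (≃-fv p) (≃-fv q)
  ≃-fv (ν p)            = ≃-fv p
  ≃-fv var              = id
  ≃-fv (rec p)          = ≃-fv p
  ≃-fv (run p _ q)      = Sum.map (≃-fv p) (≃-fv q)
  ≃-fv (dorm p q)       = Sum.map (≃-fv p) (≃-fv q)

  ≃-Closed : ∀ {A n} {P Q : Term A n} → P ≃ Q → Closed P → Closed Q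
  ≃-Closed p closed x x∈ = closed x (≃-fv (≃-sym p) x∈)

  ≃-NoDormant : ∀ {A n} {P Q : Term A n} → P ≃ Q → NoDormant P → NoDormant Q
  ≃-NoDormant (sum p) h             = λ i → ≃-NoDormant (p i) (h i)
  ≃-NoDormant (p ∣ q) (h , h′)      = ≃-NoDormant p h , ≃-NoDormant q h′
  ≃-NoDormant (ν p) h               = ≃-NoDormant p h
  ≃-NoDormant var h                 = h
  ≃-NoDormant (rec p) h             = ≃-NoDormant p h
  ≃-NoDormant (run p _ q) (h , h′)  = ≃-NoDormant p h , ≃-NoDormant q h′
  ≃-NoDormant co h                  = h

  ≃-WellFormed : ∀ {A n} {P Q : Term A n} → P ≃ Q → WellFormed P → WellFormed Q
  ≃-WellFormed (sum p) wf i with nn , nd , wf′ ← wf i =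
    ≃-NoNames (p i) nn , ≃-NoDormant (p i) nd , ≃-WellFormed (p i) wf′
  ≃-WellFormed (p ∣ q) (wf , wf′)  = ≃-WellFormed p wf , ≃-WellFormed q wf′
  ≃-WellFormed (ν p) wf            = ≃-WellFormed p wf
  ≃-WellFormed var wf              = wf
  ≃-WellFormed (rec p) (nn , wf)   = ≃-NoNames p nn , ≃-WellFormed p wf
  ≃-WellFormed (run p _ q) ((nn , nd , cl , wf) , nn′ , wf′) =
    (≃-NoNames p nn , ≃-NoDormant p nd , ≃-Closed p cl , ≃-WellFormed p wf) ,
    ≃-NoNames q nn′ , ≃-WellFormed q wf′
  ≃-WellFormed co wf               = wf
  ≃-WellFormed (dorm p q) ((nn , nd , cl , wf) , nn′ , wf′) =
    (≃-NoNames p nn , ≃-NoDormant p nd , ≃-Closed p cl , ≃-WellFormed p wf) ,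
    ≃-NoNames q nn′ , ≃-WellFormed q wf′

  ≃-IsProcess : ∀ {P Q} → P ≃ Q → IsProcess P → IsProcess Q
  ≃-IsProcess {P} {Q} p proc = record
    { closed     = ≃-Closed p closed
    ; ftn-finite = map π (proj₁ ftn-finite) , λ k k∈ →
        subst (_∈ˡ map π (proj₁ ftn-finite)) (π-involutive k)
              (∈-map⁺ π (proj₂ ftn-finite (π k) (≃-ftn (≃-sym p) k∈)))
    ; wellFormed = ≃-WellFormed p wellFormed
    }
    where open IsProcess proc

  ≃-ren : ∀ {A B n m} (g : A → B) (h : Fin n → Fin m) {P Q : Term A n} →
          P ≃ Q → ren g h P ≃ ren g h Q
  ≃-ren g h (sum p)      = sum (λ i → ≃-ren g h (p i))
  ≃-ren g h (p ∣ q)      = ≃-ren g h p ∣ ≃-ren g h q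
  ≃-ren g h (ν p)        = ν (≃-ren (Maybe.map g) h p)
  ≃-ren g h var          = var
  ≃-ren g h (rec p)      = rec (≃-ren g (Fin.lift 1 h) p)
  ≃-ren g h (run p eq q) = run (≃-ren g h p) eq (≃-ren g h q)
  ≃-ren g h co           = co
  ≃-ren g h (dorm p q)   = dorm (≃-ren g h p) (≃-ren g h q)

  ≃-liftSub : ∀ {A n m} {θ ϑ : Fin n → Term A m} →
              (∀ x → θ x ≃ ϑ x) → ∀ x → liftSub θ x ≃ liftSub ϑ x
  ≃-liftSub t zero    = var
  ≃-liftSub t (suc x) = ≃-ren id suc (t x)

  ≃-sub : ∀ {A n m} {θ ϑ : Fin n → Term A m} → (∀ x → θ x ≃ ϑ x) →
          {P Q : Term A n} → P ≃ Q → sub θ P ≃ sub ϑ Q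
  ≃-sub t (sum p)      = sum (λ i → ≃-sub t (p i))
  ≃-sub t (p ∣ q)      = ≃-sub t p ∣ ≃-sub t q
  ≃-sub t (ν p)        = ν (≃-sub (λ x → ≃-ren just id (t x)) p)
  ≃-sub t var          = t _
  ≃-sub t (rec p)      = rec (≃-sub (≃-liftSub t) p)
  ≃-sub t (run p eq q) = run (≃-sub t p) eq (≃-sub t q)
  ≃-sub t co           = co
  ≃-sub t (dorm p q)   = dorm (≃-sub t p) (≃-sub t q)

  ≃-instantiate : ∀ {A n} {P Q : Term A n} → P ≃ Q → ∀ x → instantiate P x ≃ instantiate Q x
  ≃-instantiate p zero    = p
  ≃-instantiate p (suc x) = var

  -- The two membership tests agree because `π` is injective.
  π-renameName : ∀ ls k l → renameName (map π ls) (π k) (π l) ≡ π (renameName ls k l)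
  π-renameName ls k l with l ∈? ls | π l ∈? map π ls
  ... | yes _  | yes _  = refl
  ... | no _   | no _   = refl
  ... | yes l∈ | no πl∉ = contradiction (∈-map⁺ π l∈) πl∉
  ... | no l∉  | yes πl∈ with m , m∈ , eq ← ∈-map⁻ π πl∈ =
    contradiction (subst (_∈ˡ ls) (≡.sym (π-injective eq)) m∈) l∉

  ≃-renameTr : ∀ {A n} ls k {P Q : Term A n} →
               P ≃ Q → renameTr ls k P ≃ renameTr (map π ls) (π k) Q
  ≃-renameTr ls k (sum p)        = sum (λ i → ≃-renameTr ls k (p i))
  ≃-renameTr ls k (p ∣ q)        = ≃-renameTr ls k p ∣ ≃-renameTr ls k q
  ≃-renameTr ls k (ν p)          = ν (≃-renameTr ls k p)
  ≃-renameTr ls k var            = var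
  ≃-renameTr ls k (rec p)        = rec (≃-renameTr ls k p)
  ≃-renameTr ls k (run p refl q) =
    run (≃-renameTr ls k p) (π-renameName ls k _) (≃-renameTr ls k q)
  ≃-renameTr ls k co             = co
  ≃-renameTr ls k (dorm p q)     = dorm (≃-renameTr ls k p) (≃-renameTr ls k q)

  πLabel : ∀ {A} → Label A → Label A
  πLabel (plain μ) = plain μ
  πLabel (k ⟨ μ ⟩) = π k ⟨ μ ⟩

  πSub : TrSub → TrSub
  πSub ε        = ε
  πSub (ks ↦ l) = map π ks ↦ π l

  ≃-⟦⟧ : ∀ {A n} σ {P Q : Term A n} → P ≃ Q → P ⟦ σ ⟧ ≃ Q ⟦ πSub σ ⟧
  ≃-⟦⟧ ε        p = p
  ≃-⟦⟧ (ks ↦ l) p = ≃-renameTr ks l p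

  ≃-♯ : ∀ {A n} σ {P Q : Term A n} → P ≃ Q → range σ ♯ₜ P → range (πSub σ) ♯ₜ Q
  ≃-♯ (ks ↦ l) p fresh k refl k∈ = fresh l refl (≃-ftn⁻ p k∈)

  πLabel-mapLabel : ∀ {A B} (g : A → B) α → πLabel (mapLabel g α) ≡ mapLabel g (πLabel α)
  πLabel-mapLabel g (plain μ) = refl
  πLabel-mapLabel g (k ⟨ μ ⟩) = refl

  ≃-⟶ : ∀ {A n} {P P′ Q : Term A n} {α σ} → P ⟶⟨ α ⨟ σ ⟩ P′ → P ≃ Q →
        ∃[ Q′ ] Q ⟶⟨ πLabel α ⨟ πSub σ ⟩ Q′ × P′ ≃ Q′
  ≃-⟶ (sum-step j) (sum p) = _ , sum-step j , p j
  ≃-⟶ (comm t u) (p ∣ q) with _ , t′ , p′ ← ≃-⟶ t p | _ , u′ , q′ ← ≃-⟶ u q =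
    _ , comm t′ u′ , p′ ∣ q′
  ≃-⟶ unfold (rec p) = _ , unfold , ≃-sub (≃-instantiate (rec p)) p
  ≃-⟶ (sum-embed j eq) (sum p) = _ , sum-embed j eq , run (p j ∣ co) refl (sum p)
  ≃-⟶ (run-step t k≢l) (run p refl q) with _ , t′ , p′ ← ≃-⟶ t p =
    _ , run-step t′ (k≢l ∘ π-injective) , run p′ refl q
  ≃-⟶ (merge {k = k} {ls₁} {ls₂} t u) (p ∣ q)
    with _ , t′ , p′ ← ≃-⟶ t p | _ , u′ , q′ ← ≃-⟶ u q
    rewrite map-++ π ls₁ ls₂ =
    _ , merge t′ u′ , ≃-renameTr ls₂ k p′ ∣ ≃-renameTr ls₁ k q′
  ≃-⟶ (par-left {σ = σ} t fresh) (p ∣ q) with _ , t′ , p′ ← ≃-⟶ t p =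
    _ , par-left t′ (≃-♯ σ q fresh) , p′ ∣ ≃-⟦⟧ σ q
  ≃-⟶ (par-right {σ = σ} t fresh) (p ∣ q) with _ , t′ , q′ ← ≃-⟶ t q =
    _ , par-right t′ (≃-♯ σ p fresh) , ≃-⟦⟧ σ p ∣ q′
  ≃-⟶ (res {α = α} {σ} t) (ν {P′ = Q} p) with Q′ , t′ , p′ ← ≃-⟶ t p =
    _ , res (subst (λ β → Q ⟶⟨ β ⨟ πSub σ ⟩ Q′) (πLabel-mapLabel just α) t′) , ν p′

  -- Two images of one term may differ in the functions under sums, where propositional equality is
  -- out of reach. Structural equivalence absorbs the difference through `sum-cong`, and it is all
  -- that the premise of `run-commit` asks for.
  ≃-unique : ∀ {A n} {P Q R : Term A n} → P ≃ Q → P ≃ R → Q ≡ₛ R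
  ≃-unique (sum p)        (sum q)          = sum-cong (λ _ → refl) (λ i → ≃-unique (p i) (q i))
  ≃-unique (p ∣ p′)       (q ∣ q′)         = ∣-cong (≃-unique p q) (≃-unique p′ q′)
  ≃-unique (ν p)          (ν q)            = ν-cong (≃-unique p q)
  ≃-unique var            var              = ≡-refl
  ≃-unique (rec p)        (rec q)          = rec-cong (≃-unique p q)
  ≃-unique (run p refl p′) (run q refl q′) = run-cong (≃-unique p q) (≃-unique p′ q′)
  ≃-unique co             co               = ≡-refl
  ≃-unique (dorm p p′)    (dorm q q′)      = dorm-cong (≃-unique p q) (≃-unique p′ q′)

  ≃-𝟎 : ∀ {A n} → 𝟎 {A} {n} ≃ 𝟎
  ≃-𝟎 = sum λ ()

  -- Arbitrary images are allowed at both ends so that the induction goes through: `≡-trans` picks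
  -- `image` for its middle term, and each axiom is applied to one image and then corrected by
  -- `≃-unique`.
  ≃-≡ₛ : ∀ {A n} {P P′ Q Q′ : Term A n} → P ≡ₛ P′ → P ≃ Q → P′ ≃ Q′ → Q ≡ₛ Q′
  ≃-≡ₛ ≡-refl p q = ≃-unique p q
  ≃-≡ₛ (≡-sym s) p q = ≡-sym (≃-≡ₛ s q p)
  ≃-≡ₛ (≡-trans {Q = R} s t) p q = ≡-trans (≃-≡ₛ s p (≃-image R)) (≃-≡ₛ t (≃-image R) q)
  ≃-≡ₛ (sum-cong μ s) (sum p) (sum q) = sum-cong μ (λ i → ≃-≡ₛ (s i) (p i) (q i))
  ≃-≡ₛ (∣-cong s t) (p ∣ p′) (q ∣ q′) = ∣-cong (≃-≡ₛ s p q) (≃-≡ₛ t p′ q′)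
  ≃-≡ₛ (ν-cong s) (ν p) (ν q) = ν-cong (≃-≡ₛ s p q)
  ≃-≡ₛ (rec-cong s) (rec p) (rec q) = rec-cong (≃-≡ₛ s p q)
  ≃-≡ₛ (run-cong s t) (run p refl p′) (run q refl q′) = run-cong (≃-≡ₛ s p q) (≃-≡ₛ t p′ q′)
  ≃-≡ₛ (dorm-cong s t) (dorm p p′) (dorm q q′) = dorm-cong (≃-≡ₛ s p q) (≃-≡ₛ t p′ q′)
  ≃-≡ₛ (sum-reindex g) (sum p) (sum q) =
    ≡-trans (sum-reindex g) (sum-cong (λ _ → refl) (λ i → ≃-unique (p (Inverse.to g i)) (q i)))
  ≃-≡ₛ ∣-identity (p ∣ z) q = ≡-trans (∣-cong (≃-unique p q) (≃-unique z ≃-𝟎)) ∣-identity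
  ≃-≡ₛ ∣-comm (p ∣ q) (q′ ∣ p′) = ≡-trans ∣-comm (∣-cong (≃-unique q q′) (≃-unique p p′))
  ≃-≡ₛ ∣-assoc ((p ∣ q) ∣ r) (p′ ∣ (q′ ∣ r′)) =
    ≡-trans ∣-assoc (∣-cong (≃-unique p p′) (∣-cong (≃-unique q q′) (≃-unique r r′)))
  ≃-≡ₛ ν-𝟎 (ν p) q = ≡-trans (ν-cong (≃-unique p ≃-𝟎)) (≡-trans ν-𝟎 (≃-unique ≃-𝟎 q))
  ≃-≡ₛ ν-swap (ν (ν p)) (ν (ν q)) =
    ≡-trans ν-swap (ν-cong (ν-cong (≃-unique (≃-ren swap id p) q)))
  ≃-≡ₛ ν-extrude (ν p ∣ q) (ν (p′ ∣ q′)) =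
    ≡-trans ν-extrude (ν-cong (∣-cong (≃-unique p p′) (≃-unique (≃-ren just id q) q′)))

  ≃-⇝co : ∀ {A n} {P P′ Q : Term A n} → P ⇝co P′ → P ≃ Q → ∃[ Q′ ] Q ⇝co Q′ × P′ ≃ Q′
  ≃-⇝co ⇝-co co = _ , ⇝-co , ≃-𝟎
  ≃-⇝co ⇝-sum (sum p) = _ , ⇝-sum , sum p
  ≃-⇝co ⇝-var var = _ , ⇝-var , var
  ≃-⇝co ⇝-rec (rec p) = _ , ⇝-rec , rec p
  ≃-⇝co ⇝-dorm (dorm p q) = _ , ⇝-dorm , dorm p q
  ≃-⇝co (⇝-ν t) (ν p) with _ , t′ , p′ ← ≃-⇝co t p = _ , ⇝-ν t′ , ν p′
  ≃-⇝co (⇝-∣ t u) (p ∣ q) with _ , t′ , p′ ← ≃-⇝co t p | _ , u′ , q′ ← ≃-⇝co u q =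
    _ , ⇝-∣ t′ u′ , p′ ∣ q′

  πReconf : Reconf → Reconf
  πReconf (commit k) = commit (π k)
  πReconf (abort k)  = abort (π k)
  πReconf (new k)    = new (π k)

  nameOf-πReconf : ∀ β → nameOf (πReconf β) ≡ π (nameOf β)
  nameOf-πReconf (commit k) = refl
  nameOf-πReconf (abort k)  = refl
  nameOf-πReconf (new k)    = refl

  ≃-nameOf : ∀ {A n} β {P Q : Term A n} → P ≃ Q → nameOf β ∉ ftn P → nameOf (πReconf β) ∉ ftn Q
  ≃-nameOf β {Q = Q} p fresh k∈ =
    fresh (≃-ftn⁻ p (subst (_∈ ftn Q) (nameOf-πReconf β) k∈))

  ≃-⟶ᵣ : ∀ {A n} {P P′ Q : Term A n} {β} → P ⟶ᵣ⟨ β ⟩ P′ → P ≃ Q →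
         ∃[ Q′ ] Q ⟶ᵣ⟨ πReconf β ⟩ Q′ × P′ ≃ Q′
  ≃-⟶ᵣ (run-commit {P″ = P″} s t) (run p refl q) with _ , t′ , p′ ← ≃-⇝co t p =
    _ , run-commit (≃-≡ₛ s p (co ∣ ≃-image P″)) t′ , p′
  ≃-⟶ᵣ dorm-new (dorm p q) = _ , dorm-new , run p refl q
  ≃-⟶ᵣ run-abort (run p refl q) = _ , run-abort , q
  ≃-⟶ᵣ (par-commit t u) (p ∣ q) with _ , t′ , p′ ← ≃-⟶ᵣ t p | _ , u′ , q′ ← ≃-⟶ᵣ u q =
    _ , par-commit t′ u′ , p′ ∣ q′
  ≃-⟶ᵣ (par-abort t u) (p ∣ q) with _ , t′ , p′ ← ≃-⟶ᵣ t p | _ , u′ , q′ ← ≃-⟶ᵣ u q =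
    _ , par-abort t′ u′ , p′ ∣ q′
  ≃-⟶ᵣ (par-left {β = β} t fresh) (p ∣ q) with _ , t′ , p′ ← ≃-⟶ᵣ t p =
    _ , par-left t′ (≃-nameOf β q fresh) , p′ ∣ q
  ≃-⟶ᵣ (par-right {β = β} t fresh) (p ∣ q) with _ , t′ , q′ ← ≃-⟶ᵣ t q =
    _ , par-right t′ (≃-nameOf β p fresh) , p ∣ q′
  ≃-⟶ᵣ (res t) (ν p) with _ , t′ , p′ ← ≃-⟶ᵣ t p = _ , res t′ , ν p′

  π-map-involutive : ∀ ls → map π (map π ls) ≡ ls
  π-map-involutive []       = refl
  π-map-involutive (l ∷ ls) = ≡.cong₂ _∷_ (π-involutive l) (π-map-involutive ls)

  πSub-involutive : ∀ σ → πSub (πSub σ) ≡ σ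
  πSub-involutive ε        = refl
  πSub-involutive (ks ↦ l) = ≡.cong₂ _↦_ (π-map-involutive ks) (π-involutive l)

  πEntry : Maybe (exTrN × Status) → Maybe (exTrN × Status)
  πEntry = Maybe.map (map₁ f)

  πEntry-involutive : ∀ h → πEntry (πEntry h) ≡ h
  πEntry-involutive nothing        = refl
  πEntry-involutive (just (k , s)) = cong (λ l → just (l , s)) (f-involutive k)

  πEntry⁻ : ∀ {h k s} → πEntry h ≡ just (k , s) → h ≡ just (f k , s)
  πEntry⁻ {h} eq = ≡.trans (≡.sym (πEntry-involutive h)) (cong πEntry eq)

  infix 4 _≅_ _≅ₒ_

  -- Since `π` is its own inverse, `E≅⁻` can be written with `π` again; the relation is then
  -- symmetric by exchanging the two fields.
  record _≅_ (C D : Config) : Set₁ where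
    field
      proc≃ : proc C ≃ proc D
      E≅    : ∀ {k l} → E C k l → E D (π k) (π l)
      E≅⁻   : ∀ {k l} → E D k l → E C (π k) (π l)
      H≅    : ∀ i → H D i ≡ πEntry (H C i)

  open _≅_

  ≅-sym : ∀ {C D} → C ≅ D → D ≅ C
  ≅-sym C≅D = record
    { proc≃ = ≃-sym (proc≃ C≅D)
    ; E≅    = E≅⁻ C≅D
    ; E≅⁻   = E≅ C≅D
    ; H≅    = λ i → ≡.trans (≡.sym (πEntry-involutive _)) (cong πEntry (≡.sym (H≅ C≅D i)))
    }

  E-π : ∀ (E : Rel TrN 0ℓ) {k l} → E k l → E (π (π k)) (π (π l))
  E-π E = subst₂ E (≡.sym (π-involutive _)) (≡.sym (π-involutive _))

  E-π⁻ : ∀ (E : Rel TrN 0ℓ) {k l} → E (π (π k)) (π (π l)) → E k l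
  E-π⁻ E = subst₂ E (π-involutive _) (π-involutive _)

  -- The process is a parameter because `≃-⟶` and `≃-⟶ᵣ` produce their own targets, which need not
  -- be `image (proc C)`.
  renamed : ∀ C {P} → proc C ≃ P → Config
  renamed C {P} p = record
    { E         = λ k l → E C (π k) (π l)
    ; H         = πEntry ∘ H C
    ; proc      = P
    ; isProcess = ≃-IsProcess p (isProcess C)
    ; E-per     = record { sym = Per.sym ; trans = Per.trans }
    ; E-finite  = map π (proj₁ (E-finite C)) , λ k kEk →
        subst (_∈ˡ map π (proj₁ (E-finite C))) (π-involutive k)
              (∈-map⁺ π (proj₂ (E-finite C) (π k) kEk))
    ; H-finite  = proj₁ (H-finite C) , λ i Hi≢ → proj₂ (H-finite C) i (Hi≢ ∘ cong πEntry)
    ; H-unique  = λ eq eq′ → H-unique C (πEntry⁻ eq) (πEntry⁻ eq′)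
    ; E-H       = λ k → mk⇔
        (λ kEk → names⁺ (Equivalence.to (E-H C (f k)) kEk))
        (λ (i , s , eq) → Equivalence.from (E-H C (f k)) (i , s , πEntry⁻ eq))
    ; E-Hasco   = λ kEl → mk⇔
        (λ (i , eq) → committed⁺ (Equivalence.to (E-Hasco C kEl) (i , πEntry⁻ eq)))
        (λ (i , eq) → committed⁺ (Equivalence.from (E-Hasco C kEl) (i , πEntry⁻ eq)))
    ; ftn-Hasco = λ k∈ (i , eq) → ftn-Hasco C (≃-ftn (≃-sym p) k∈) (i , πEntry⁻ eq)
    ; E-ftn     = λ kEl k∈ l∈ →
        π-injective (E-ftn C kEl (≃-ftn (≃-sym p) k∈) (≃-ftn (≃-sym p) l∈))
    ; ftn-ext   = λ k∈ → names⁺ (ftn-ext C (≃-ftn (≃-sym p) k∈))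
    }
    where
    module Per = IsPartialEquivalence (E-per C)
    πEntry⁺ : ∀ {h k s} → h ≡ just (f k , s) → πEntry h ≡ just (k , s)
    πEntry⁺ refl = cong (λ l → just (l , _)) (f-involutive _)
    names⁺ : ∀ {k} → f k ∈ Hᵗʳⁿ (H C) → k ∈ Hᵗʳⁿ (πEntry ∘ H C)
    names⁺ (i , s , eq) = i , s , πEntry⁺ eq
    committed⁺ : ∀ {k} → f k ∈ Hasco (H C) → k ∈ Hasco (πEntry ∘ H C)
    committed⁺ (i , eq) = i , πEntry⁺ eq

  ≅-renamed : ∀ C {P} (p : proc C ≃ P) → C ≅ renamed C p
  ≅-renamed C p = record { proc≃ = p ; E≅ = E-π (E C) ; E≅⁻ = id ; H≅ = λ _ → refl }

  ≅-entry : ∀ {C D} → C ≅ D → ∀ {i k s} → H C i ≡ just (k , s) → H D i ≡ just (f k , s)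
  ≅-entry C≅D {i} eq = ≡.trans (H≅ C≅D i) (cong πEntry eq)

  ≅-Hasco : ∀ {C D} → C ≅ D → ∀ {k} → k ∈ Hasco (H C) → f k ∈ Hasco (H D)
  ≅-Hasco C≅D (i , eq) = i , ≅-entry C≅D eq

  ≅-♯Δ : ∀ {C D} → C ≅ D → ∀ {k} → k ♯Δ C → π k ♯Δ D
  ≅-♯Δ {C} {D} C≅D {k} (k♯E , k♯H) =
    (λ l kEl → k♯E (π l) (subst (λ m → E C m (π l)) (π-involutive k) (E≅⁻ C≅D kEl))) ,
    (λ l (i , s , eq) πk≡l → k♯H (f l) (i , s , ≅-entry (≅-sym C≅D) eq)
      (≡.trans (≡.sym (π-involutive k)) (cong π πk≡l)))

  π-σ⦅⦆ : ∀ {σ} {E₁ E₂ : Rel TrN 0ℓ} → (∀ {k l} → E₁ k l → E₂ (π k) (π l)) →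
          ∀ {k l} → (σ ⦅ E₁ ⦆) k l → (πSub σ ⦅ E₂ ⦆) (π k) (π l)
  π-σ⦅⦆ g (base kEl)    = base (g kEl)
  π-σ⦅⦆ g (rng refl)    = rng refl
  π-σ⦅⦆ g (dom refl k∈) = dom refl (∈-map⁺ π k∈)
  π-σ⦅⦆ g (sym F)       = sym (π-σ⦅⦆ g F)
  π-σ⦅⦆ g (trans F G)   = trans (π-σ⦅⦆ g F) (π-σ⦅⦆ g G)

  module _ {C D : Config} (C≅D : C ≅ D) (C′ : Config) {P : Term Chan 0} (p : proc C′ ≃ P) where

    ≅-E : E C′ ⇔ʳ E C → E (renamed C′ p) ⇔ʳ E D
    ≅-E (to , from) = (λ F → E-π⁻ (E D) (E≅ C≅D (to F))) , (λ F → from (E≅⁻ C≅D F))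

    ≅-H : (∀ i → H C′ i ≡ H C i) → ∀ i → H (renamed C′ p) i ≡ H D i
    ≅-H same i = ≡.trans (cong πEntry (same i)) (≡.sym (H≅ C≅D i))

    ≅-SameΔ : SameΔ C C′ → SameΔ D (renamed C′ p)
    ≅-SameΔ (sameE , sameH) = ≅-E sameE , ≅-H sameH

    ≅-σ⦅⦆ : ∀ {σ} → E C′ ⇔ʳ (σ ⦅ E C ⦆) → E (renamed C′ p) ⇔ʳ (πSub σ ⦅ E D ⦆)
    ≅-σ⦅⦆ {σ} (to , from) =
      (λ F → E-π⁻ (πSub σ ⦅ E D ⦆) (π-σ⦅⦆ (E≅ C≅D) (to F))) ,
      (λ F → from (subst (λ σ → (σ ⦅ E C ⦆) _ _) (πSub-involutive σ) (π-σ⦅⦆ (E≅⁻ C≅D) F)))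

    ≅-Extends : ∀ {k s} → Extends (H C) (k , s) (H C′) →
                Extends (H D) (f k , s) (H (renamed C′ p))
    ≅-Extends (i , free , at-i , rest) =
      i , ≡.trans (H≅ C≅D i) (cong πEntry free) , cong πEntry at-i ,
      λ j j≢i → ≡.trans (cong πEntry (rest j j≢i)) (≡.sym (H≅ C≅D j))

    ≅-Resolve : ∀ {s k} → Resolve s k C C′ → Resolve s (π k) D (renamed C′ p)
    ≅-Resolve {s} {k} (sameE , update) = ≅-E sameE , λ i →
      subst (λ h → Update (Eext (E D) (π k)) s h (πEntry (H C′ i))) (≡.sym (H≅ C≅D i))
            (≅-Update (update i))
      where
      ≅-Update : ∀ {h h′} → Update (Eext (E C) k) s h h′ →
                 Update (Eext (E D) (π k)) s (πEntry h) (πEntry h′)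
      ≅-Update undefined     = undefined
      ≅-Update (affected k∈) = affected (E≅ C≅D k∈)
      ≅-Update (spared k∉)   = spared (λ k∈ → k∉ (E-π⁻ (E C) (E≅⁻ C≅D k∈)))
      ≅-Update aborted       = aborted
      ≅-Update committed     = committed

    ≅-,, : ∀ {k} → E C′ ⇔ʳ (E C ,, k) → E (renamed C′ p) ⇔ʳ (E D ,, π k)
    ≅-,, {k} (to , from) =
      (λ F → Sum.map (λ G → E-π⁻ (E D) (E≅ C≅D G))
                     (λ (eq , eq′) → flip eq , flip eq′) (to F)) ,
      (λ F → from (Sum.map (E≅⁻ C≅D) (λ (eq , eq′) → unflip eq , unflip eq′) F))
      where
      flip : ∀ {k l} → π k ≡ l → k ≡ π l
      flip eq = ≡.trans (≡.sym (π-involutive _)) (cong π eq)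
      unflip : ∀ {k l} → k ≡ π l → π k ≡ l
      unflip eq = ≡.trans (cong π eq) (π-involutive _)

  -- Sets of committed names are matched by two inclusions, as predicates are compared only
  -- extensionally.
  data _≅ₒ_ : Obs → Obs → Set₁ where
    τ    : τ ≅ₒ τ
    _⟨_⟩ : ∀ k a → (k ⟨ a ⟩) ≅ₒ (f k ⟨ a ⟩)
    co   : ∀ {K K′} → (∀ {k} → k ∈ K → f k ∈ K′) → (∀ {k} → k ∈ K′ → f k ∈ K) → co K ≅ₒ co K′

  ≅-—→ : ∀ {C C′ D ζ ξ s} → C —[ ζ ]→⟨ s ⟩ C′ → C ≅ D → ζ ≅ₒ ξ →
         ∃[ D′ ] D —[ ξ ]→⟨ s ⟩ D′ × C′ ≅ D′
  ≅-—→ {C′ = C′} (silent t same) C≅D τ with _ , t′ , p ← ≃-⟶ t (proc≃ C≅D) =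
    renamed C′ p , silent t′ (≅-SameΔ C≅D C′ p same) , ≅-renamed C′ p
  ≅-—→ {C′ = C′} (internal t fresh sameE sameH) C≅D τ with _ , t′ , p ← ≃-⟶ t (proc≃ C≅D) =
    renamed C′ p ,
    internal t′ (≅-♯Δ C≅D fresh) (≅-σ⦅⦆ C≅D C′ p sameE) (≅-H C≅D C′ p sameH) , ≅-renamed C′ p
  ≅-—→ {C′ = C′} (activate t fresh same) C≅D τ with _ , t′ , p ← ≃-⟶ᵣ t (proc≃ C≅D) =
    renamed C′ p , activate t′ (≅-♯Δ C≅D fresh) (≅-SameΔ C≅D C′ p same) , ≅-renamed C′ p
  ≅-—→ {C′ = C′} (abort t upd) C≅D τ with _ , t′ , p ← ≃-⟶ᵣ t (proc≃ C≅D) =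
    renamed C′ p , abort t′ (≅-Resolve C≅D C′ p upd) , ≅-renamed C′ p
  ≅-—→ {C′ = C′} (visible t fresh sameE H+) C≅D (k ⟨ a ⟩) with _ , t′ , p ← ≃-⟶ t (proc≃ C≅D) =
    renamed C′ p ,
    visible t′ (≅-♯Δ C≅D fresh) (≅-σ⦅⦆ C≅D C′ p sameE) (≅-Extends C≅D C′ p H+) , ≅-renamed C′ p
  -- The process does not change, so `proc D` itself serves as the renamed process and the required
  -- equation is `refl`.
  ≅-—→ {C} {C′} {D} (ignored eq fresh k∉ sameE H+) C≅D (k ⟨ a ⟩) =
    renamed C′ p ,
    ignored refl (≅-♯Δ C≅D fresh) (k∉ ∘ ≃-ftn⁻ (proc≃ C≅D)) (≅-,, C≅D C′ p sameE)
            (≅-Extends C≅D C′ p H+) ,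
    ≅-renamed C′ p
    where
    p : proc C′ ≃ proc D
    p = subst (_≃ proc D) (≡.sym eq) (proc≃ C≅D)
  ≅-—→ {C′ = C′} (commit-e t upd) C≅D τ with _ , t′ , p ← ≃-⟶ᵣ t (proc≃ C≅D) =
    renamed C′ p , commit-e t′ (≅-Resolve C≅D C′ p upd) , ≅-renamed C′ p
  ≅-—→ {C} {C′} {D} (commit-c t upd (l , kEl) (K⊆ , K⊇)) C≅D (co {K′ = K′} to from)
    with _ , t′ , p ← ≃-⟶ᵣ t (proc≃ C≅D) =
    renamed C′ p ,
    commit-c t′ (≅-Resolve C≅D C′ p upd) (f l , E≅ C≅D kEl)
      ( (λ k∈ → subst (E D _) (π-involutive _) (E≅ C≅D (K⊆ (from k∈))))
      , (λ {l} F → subst (_∈ K′) (f-involutive l)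
          (to (K⊇ (subst (λ k → E C k _) (π-involutive _) (E≅⁻ C≅D F))))) ) ,
    ≅-renamed C′ p
  ≅-—→ {C} {C′ = C′} (commit-τ {k = k} t upd none) C≅D τ with _ , t′ , p ← ≃-⟶ᵣ t (proc≃ C≅D) =
    renamed C′ p ,
    commit-τ t′ (≅-Resolve C≅D C′ p upd)
      (λ l F → none (f l) (subst (λ k → E C k _) (π-involutive k) (E≅⁻ C≅D F))) ,
    ≅-renamed C′ p

  ≅-⇒τ : ∀ {C C′ D s} → C =[τ]⇒⟨ s ⟩ C′ → C ≅ D → ∃[ D′ ] D =[τ]⇒⟨ s ⟩ D′ × C′ ≅ D′
  ≅-⇒τ [] C≅D = _ , [] , C≅D
  ≅-⇒τ (t ◅ ts) C≅D with _ , u , C≅D′ ← ≅-—→ t C≅D τ with _ , us , C≅D″ ← ≅-⇒τ ts C≅D′ =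
    _ , u ◅ us , C≅D″

  ≅-⇒ : ∀ {C C′ D ζ ξ s} → C =[ ζ ]⇒⟨ s ⟩ C′ → C ≅ D → ζ ≅ₒ ξ →
        ∃[ D′ ] D =[ ξ ]⇒⟨ s ⟩ D′ × C′ ≅ D′
  ≅-⇒ ts C≅D τ = ≅-⇒τ ts C≅D
  ≅-⇒ (_ , _ , ts , t , ts′) C≅D o@(k ⟨ a ⟩)
    with _ , us , C≅D ← ≅-⇒τ ts C≅D with _ , u , C≅D ← ≅-—→ t C≅D o
    with _ , us′ , C≅D ← ≅-⇒τ ts′ C≅D = _ , (_ , _ , us , u , us′) , C≅D
  ≅-⇒ (_ , _ , ts , t , ts′) C≅D o@(co _ _)
    with _ , us , C≅D ← ≅-⇒τ ts C≅D with _ , u , C≅D ← ≅-—→ t C≅D o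
    with _ , us′ , C≅D ← ≅-⇒τ ts′ C≅D = _ , (_ , _ , us , u , us′) , C≅D

  ≅-env : ∀ {n} {ρ ρ′ : Vec exTrN n} → (∀ x → lookup ρ′ x ≡ f (lookup ρ x)) →
          ∀ x → lookup ρ x ≡ f (lookup ρ′ x)
  ≅-env ρ≅ x = ≡.trans (≡.sym (f-involutive _)) (cong f (≡.sym (ρ≅ x)))

  ≅-valueₛ : ∀ {n} {ρ ρ′ : Vec exTrN n} → (∀ x → lookup ρ′ x ≡ f (lookup ρ x)) →
             ∀ K {k} → k ∈ valueₛ ρ (vars K) → f k ∈ valueₛ ρ′ (vars K)
  ≅-valueₛ ρ≅ K (inj₂ x , x∈ , refl) = inj₂ x , x∈ , ρ≅ x

  -- A pure formula mentions no names, so only the environment has to be renamed. A name `l` chosen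
  -- on the right is answered by `f l` on the left, which is why the excluded list is mapped by `f`.
  ≅-⊨ : ∀ {ℒ n} (φ : Pure ℒ n) {ρ ρ′ : Vec exTrN n} {C D} →
        (∀ x → lookup ρ′ x ≡ f (lookup ρ x)) → C ≅ D → C ⊨[ ρ ] ⌊ φ ⌋ → D ⊨[ ρ′ ] ⌊ φ ⌋
  ≅-⊨ (⟨τ⟩ φ) ρ≅ C≅D (C′ , ts , sat) with D′ , us , C≅D′ ← ≅-⇒τ ts C≅D =
    D′ , us , ≅-⊨ φ ρ≅ C≅D′ sat
  ≅-⊨ {ℒ} {n} (⟨x⟨ a ⟩⟩ φ) {ρ} {ρ′} {C} {D} ρ≅ C≅D (excl , sat) = map f excl , transfer
    where
    transfer : ∀ l → l ∉ˡ map f excl → ∃[ D′ ] D =[ l ⟨ a ⟩ ]⇒⟨ sem ℒ ⟩ D′ × D′ ⊨[ l ∷ ρ′ ] ⌊ φ ⌋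
    transfer l l∉
      with C′ , t , sat′ ← sat (f l) (λ fl∈ →
             l∉ (subst (_∈ˡ map f excl) (f-involutive l) (∈-map⁺ f fl∈)))
      with D′ , u , C≅D′ ← ≅-⇒ t C≅D (f l ⟨ a ⟩) =
      D′ , subst (λ m → D =[ m ⟨ a ⟩ ]⇒⟨ sem ℒ ⟩ D′) (f-involutive l) u ,
      ≅-⊨ φ (λ { zero → ≡.sym (f-involutive l) ; (suc x) → ρ≅ x }) C≅D′ sat′
  ≅-⊨ (∼ φ) {ρ} {ρ′} ρ≅ C≅D unsat sat = unsat (≅-⊨ φ (≅-env {ρ = ρ} {ρ′} ρ≅) (≅-sym C≅D) sat)
  ≅-⊨ (⋀ M φ) ρ≅ C≅D sat i = ≅-⊨ (φ i) ρ≅ C≅D (sat i)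
  ≅-⊨ (hasco x) {D = D} ρ≅ C≅D (lift k∈) =
    lift (subst (_∈ Hasco (H D)) (≡.sym (ρ≅ x)) (≅-Hasco C≅D k∈))
  ≅-⊨ (x =co y) {D = D} ρ≅ C≅D (lift ((k∈ , l∈) , kEl)) = lift
    ( ( subst (_∈ Hasco (H D)) (≡.sym (ρ≅ x)) (≅-Hasco C≅D k∈)
      , subst (_∈ Hasco (H D)) (≡.sym (ρ≅ y)) (≅-Hasco C≅D l∈) )
    , subst₂ (λ k l → E D (ext k) (ext l)) (≡.sym (ρ≅ x)) (≡.sym (ρ≅ y)) (E≅ C≅D kEl) )
  ≅-⊨ (⟨co K ∣ _ ⟩ φ) {ρ} {ρ′} ρ≅ C≅D (C′ , t , sat)
    with D′ , u , C≅D′ ← ≅-⇒ t C≅D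
           (co (≅-valueₛ {ρ = ρ} {ρ′} ρ≅ K)
               (≅-valueₛ {ρ = ρ′} {ρ} (≅-env {ρ = ρ} {ρ′} ρ≅) K)) =
    D′ , u , ≅-⊨ φ ρ≅ C≅D′ sat

-- Transaction names of processes, and soundness of histories

module Names (S : Signature) where
  open Signature S
  open TCCS S
  open Config
  open DecMembership _≟TrN_ using (_∈?_)

  ftn-ren : ∀ {A B n m} (g : A → B) (h : Fin n → Fin m) (P : Term A n) →
            ftn (ren g h P) ⊆ ftn P
  ftn-ren g h (sum J ι μ P) (i , k∈) = i , ftn-ren g h (P i) k∈
  ftn-ren g h (P ∣ Q)                = Sum.map (ftn-ren g h P) (ftn-ren g h Q)
  ftn-ren g h (ν P)                  = ftn-ren (Maybe.map g) h P
  ftn-ren g h (rec P)                = ftn-ren g (Fin.lift 1 h) P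
  ftn-ren g h (run P l Q)            = map₂ (Sum.map (ftn-ren g h P) (ftn-ren g h Q))
  ftn-ren g h (dorm P Q)             = Sum.map (ftn-ren g h P) (ftn-ren g h Q)

  ftn-sub : ∀ {A n m} {N : Pred TrN 0ℓ} (θ : Fin n → Term A m) → (∀ x → ftn (θ x) ⊆ N) →
            ∀ P → ftn P ⊆ N → ftn (sub θ P) ⊆ N
  ftn-sub θ t (sum J ι μ P) p (i , k∈) = ftn-sub θ t (P i) (λ k∈ → p (i , k∈)) k∈
  ftn-sub θ t (P ∣ Q) p =
    Sum.[ ftn-sub θ t P (p ∘ inj₁) , ftn-sub θ t Q (p ∘ inj₂) ]
  ftn-sub θ t (ν P) p = ftn-sub _ (λ x k∈ → t x (ftn-ren just id (θ x) k∈)) P p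
  ftn-sub θ t (var x) p = t x
  ftn-sub {N = N} θ t (rec P) p = ftn-sub (liftSub θ) t′ P p
    where
    t′ : ∀ x → ftn (liftSub θ x) ⊆ N
    t′ zero    ()
    t′ (suc x) k∈ = t x (ftn-ren id suc (θ x) k∈)
  ftn-sub θ t (run P l Q) p (inj₁ eq) = p (inj₁ eq)
  ftn-sub θ t (run P l Q) p (inj₂ k∈) =
    Sum.[ ftn-sub θ t P (p ∘ inj₂ ∘ inj₁) , ftn-sub θ t Q (p ∘ inj₂ ∘ inj₂) ] k∈
  ftn-sub θ t (dorm P Q) p =
    Sum.[ ftn-sub θ t P (p ∘ inj₁) , ftn-sub θ t Q (p ∘ inj₂) ]

  ftn-renameTr : ∀ {A n} ls l (P : Term A n) {k} →
                 k ∈ ftn (renameTr ls l P) → k ∈ ftn P ⊎ k ≡ l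
  ftn-renameTr ls l (sum J ι μ P) (i , k∈) = Sum.map₁ (i ,_) (ftn-renameTr ls l (P i) k∈)
  ftn-renameTr ls l (P ∣ Q) (inj₁ k∈) = Sum.map₁ inj₁ (ftn-renameTr ls l P k∈)
  ftn-renameTr ls l (P ∣ Q) (inj₂ k∈) = Sum.map₁ inj₂ (ftn-renameTr ls l Q k∈)
  ftn-renameTr ls l (ν P) k∈ = ftn-renameTr ls l P k∈
  ftn-renameTr ls l (rec P) k∈ = ftn-renameTr ls l P k∈
  ftn-renameTr ls l (run P m Q) (inj₁ refl) with m ∈? ls
  ... | yes _ = inj₂ refl
  ... | no _  = inj₁ (inj₁ refl)
  ftn-renameTr ls l (run P m Q) (inj₂ (inj₁ k∈)) =
    Sum.map₁ (inj₂ ∘ inj₁) (ftn-renameTr ls l P k∈)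
  ftn-renameTr ls l (run P m Q) (inj₂ (inj₂ k∈)) =
    Sum.map₁ (inj₂ ∘ inj₂) (ftn-renameTr ls l Q k∈)
  ftn-renameTr ls l (dorm P Q) (inj₁ k∈) = Sum.map₁ inj₁ (ftn-renameTr ls l P k∈)
  ftn-renameTr ls l (dorm P Q) (inj₂ k∈) = Sum.map₁ inj₂ (ftn-renameTr ls l Q k∈)

  ftn-⟦⟧ : ∀ {A n} σ (P : Term A n) {k} → k ∈ ftn (P ⟦ σ ⟧) → k ∈ ftn P ⊎ k ∈ range σ
  ftn-⟦⟧ ε        P k∈ = inj₁ k∈
  ftn-⟦⟧ (ls ↦ l) P k∈ = ftn-renameTr ls l P k∈

  ⟶-ftn : ∀ {A n} {P P′ : Term A n} {α σ} → P ⟶⟨ α ⨟ σ ⟩ P′ →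
          ∀ {k} → k ∈ ftn P′ → k ∈ ftn P ⊎ k ∈ range σ
  ⟶-ftn (sum-step j) k∈ = inj₁ (j , k∈)
  ⟶-ftn (comm t u) (inj₁ k∈) = Sum.map₁ inj₁ (⟶-ftn t k∈)
  ⟶-ftn (comm t u) (inj₂ k∈) = Sum.map₁ inj₂ (⟶-ftn u k∈)
  ⟶-ftn (unfold {P}) k∈ = inj₁ (ftn-sub _ (λ { zero → id ; (suc x) () }) P id k∈)
  ⟶-ftn (sum-embed j eq) (inj₁ refl) = inj₂ refl
  ⟶-ftn (sum-embed j eq) (inj₂ (inj₁ (inj₁ k∈))) = inj₁ (j , k∈)
  ⟶-ftn (sum-embed j eq) (inj₂ (inj₂ k∈)) = inj₁ k∈
  ⟶-ftn (run-step t _) (inj₁ refl) = inj₂ refl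
  ⟶-ftn (run-step t _) (inj₂ (inj₁ k∈)) = Sum.map (inj₂ ∘ inj₁) (λ ()) (⟶-ftn t k∈)
  ⟶-ftn (run-step t _) (inj₂ (inj₂ k∈)) = inj₁ (inj₂ (inj₂ k∈))
  ⟶-ftn (merge {P′ = P′} {ls₂ = ls₂} t u) (inj₁ k∈) =
    Sum.[ (λ k∈ → Sum.map₁ inj₁ (⟶-ftn t k∈)) , inj₂ ] (ftn-renameTr ls₂ _ P′ k∈)
  ⟶-ftn (merge {Q′ = Q′} {ls₁ = ls₁} t u) (inj₂ k∈) =
    Sum.[ (λ k∈ → Sum.map₁ inj₂ (⟶-ftn u k∈)) , inj₂ ] (ftn-renameTr ls₁ _ Q′ k∈)
  ⟶-ftn (par-left t _) (inj₁ k∈) = Sum.map₁ inj₁ (⟶-ftn t k∈)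
  ⟶-ftn (par-left {Q = Q} {σ = σ} t _) (inj₂ k∈) = Sum.map₁ inj₂ (ftn-⟦⟧ σ Q k∈)
  ⟶-ftn (par-right {P = P} {σ = σ} t _) (inj₁ k∈) = Sum.map₁ inj₁ (ftn-⟦⟧ σ P k∈)
  ⟶-ftn (par-right t _) (inj₂ k∈) = Sum.map₁ inj₂ (⟶-ftn t k∈)
  ⟶-ftn (res t) k∈ = ⟶-ftn t k∈

  ⟶-dom : ∀ {A n} {P P′ : Term A n} {α ls l} → P ⟶⟨ α ⨟ ls ↦ l ⟩ P′ →
          ∀ {k} → k ∈ˡ ls → k ∈ ftn P
  ⟶-dom (run-step t _) (here refl) = inj₁ refl
  ⟶-dom (merge {ls₁ = ls₁} t u) k∈ = Sum.map (⟶-dom t) (⟶-dom u) (∈-++⁻ ls₁ k∈)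
  ⟶-dom (par-left t _) k∈ = inj₁ (⟶-dom t k∈)
  ⟶-dom (par-right t _) k∈ = inj₂ (⟶-dom t k∈)
  ⟶-dom (res t) k∈ = ⟶-dom t k∈

  ⟶-range : ∀ {A n} {P P′ : Term A n} {k μ σ} → P ⟶⟨ k ⟨ μ ⟩ ⨟ σ ⟩ P′ → ∃[ ls ] σ ≡ ls ↦ k
  ⟶-range (sum-embed j eq) = _ , refl
  ⟶-range (run-step t _)   = _ , refl
  ⟶-range (merge t u)      = _ , refl
  ⟶-range (par-left t _)   = ⟶-range t
  ⟶-range (par-right t _)  = ⟶-range t
  ⟶-range (res t)          = ⟶-range t

  ⇝co-ftn : ∀ {A n} {P P′ : Term A n} → P ⇝co P′ → ftn P′ ⊆ ftn P
  ⇝co-ftn ⇝-sum    k∈ = k∈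
  ⇝co-ftn ⇝-rec    k∈ = k∈
  ⇝co-ftn ⇝-dorm   k∈ = k∈
  ⇝co-ftn (⇝-ν t)  k∈ = ⇝co-ftn t k∈
  ⇝co-ftn (⇝-∣ t u)   = Sum.map (⇝co-ftn t) (⇝co-ftn u)

  new-ftn : ∀ {A n} {P P′ : Term A n} {k} → P ⟶ᵣ⟨ new k ⟩ P′ →
            ∀ {l} → l ∈ ftn P′ → l ∈ ftn P ⊎ l ≡ k
  new-ftn dorm-new (inj₁ refl) = inj₂ refl
  new-ftn dorm-new (inj₂ l∈) = inj₁ l∈
  new-ftn (par-left t _) (inj₁ l∈) = Sum.map₁ inj₁ (new-ftn t l∈)
  new-ftn (par-left t _) (inj₂ l∈) = inj₁ (inj₂ l∈)
  new-ftn (par-right t _) (inj₁ l∈) = inj₁ (inj₁ l∈)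
  new-ftn (par-right t _) (inj₂ l∈) = Sum.map₁ inj₂ (new-ftn t l∈)
  new-ftn (res t) l∈ = new-ftn t l∈

  record Resolves {A n} (k : TrN) (P P′ : Term A n) : Set where
    constructor resolves
    field
      before : k ∈ ftn P
      after  : k ∉ ftn P′
      ftn⊆   : ftn P′ ⊆ ftn P

  resolves-both : ∀ {A n k} {P P′ Q Q′ : Term A n} →
                  Resolves k P P′ → Resolves k Q Q′ → Resolves k (P ∣ Q) (P′ ∣ Q′)
  resolves-both (resolves k∈ k∉ p) (resolves _ k∉′ q) =
    resolves (inj₁ k∈) Sum.[ k∉ , k∉′ ] (Sum.map p q)

  resolves-left : ∀ {A n k} {P P′ Q : Term A n} →
                  Resolves k P P′ → k ∉ ftn Q → Resolves k (P ∣ Q) (P′ ∣ Q)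
  resolves-left (resolves k∈ k∉ p) k∉′ = resolves (inj₁ k∈) Sum.[ k∉ , k∉′ ] (Sum.map₁ p)

  resolves-right : ∀ {A n k} {P Q Q′ : Term A n} →
                   Resolves k Q Q′ → k ∉ ftn P → Resolves k (P ∣ Q) (P ∣ Q′)
  resolves-right (resolves k∈ k∉ q) k∉′ = resolves (inj₂ k∈) Sum.[ k∉′ , k∉ ] (Sum.map₂ q)

  -- Well-formedness keeps names out of the body of a running transaction, so the committed body
  -- cannot mention `k` again, and the side conditions of `par-left` and `par-right` exclude further
  -- occurrences in parallel.
  commit-resolves : ∀ {A n} {P P′ : Term A n} {k} → P ⟶ᵣ⟨ commit k ⟩ P′ → WellFormed P →
                    Resolves k P P′
  commit-resolves (run-commit _ t) ((none , _) , _) =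
    resolves (inj₁ refl) (λ k∈ → none _ (⇝co-ftn t k∈)) (λ l∈ → inj₂ (inj₁ (⇝co-ftn t l∈)))
  commit-resolves (par-commit t u) (wf , wf′) =
    resolves-both (commit-resolves t wf) (commit-resolves u wf′)
  commit-resolves (par-left t k∉) (wf , _) = resolves-left (commit-resolves t wf) k∉
  commit-resolves (par-right t k∉) (_ , wf) = resolves-right (commit-resolves t wf) k∉
  commit-resolves (res t) wf with resolves k∈ k∉ p ← commit-resolves t wf = resolves k∈ k∉ p

  abort-resolves : ∀ {A n} {P P′ : Term A n} {k} → P ⟶ᵣ⟨ abort k ⟩ P′ → WellFormed P →
                   Resolves k P P′
  abort-resolves run-abort (_ , none , _) =
    resolves (inj₁ refl) (none _) (λ l∈ → inj₂ (inj₂ l∈))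
  abort-resolves (par-abort t u) (wf , wf′) =
    resolves-both (abort-resolves t wf) (abort-resolves u wf′)
  abort-resolves (par-left t k∉) (wf , _) = resolves-left (abort-resolves t wf) k∉
  abort-resolves (par-right t k∉) (_ , wf) = resolves-right (abort-resolves t wf) k∉
  abort-resolves (res t) wf with resolves k∈ k∉ p ← abort-resolves t wf = resolves k∈ k∉ p

  -- Once `N` is closed under `E`, the union of `E` with all pairs from `N` is already a partial
  -- equivalence, so the closure that generates `σ(E)` stays inside it.
  σ⦅⦆-split : ∀ {ls l} {E : Rel TrN 0ℓ} {N : Pred TrN 0ℓ} → IsPartialEquivalence E →
              (∀ {k k′} → E k k′ → k ∈ N → k′ ∈ N) → l ∈ N → (∀ {k} → k ∈ˡ ls → k ∈ N) →
              ∀ {k k′} → ((ls ↦ l) ⦅ E ⦆) k k′ → E k k′ ⊎ (k ∈ N × k′ ∈ N)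
  σ⦅⦆-split {ls} {l} {E} {N} per closed l∈ ls⊆ = split
    where
    module Per = IsPartialEquivalence per
    split : ∀ {k k′} → ((ls ↦ l) ⦅ E ⦆) k k′ → E k k′ ⊎ (k ∈ N × k′ ∈ N)
    split (base kEk′)   = inj₁ kEk′
    split (rng refl)    = inj₂ (l∈ , l∈)
    split (dom refl k∈) = inj₂ (ls⊆ k∈ , l∈)
    split (sym F)       = Sum.map Per.sym (λ (k∈ , k′∈) → k′∈ , k∈) (split F)
    split (trans F G) with split F | split G
    ... | inj₁ kEk′       | inj₁ k′Ek″      = inj₁ (Per.trans kEk′ k′Ek″)
    ... | inj₁ kEk′       | inj₂ (k′∈ , k″∈) = inj₂ (closed (Per.sym kEk′) k′∈ , k″∈)
    ... | inj₂ (k∈ , k′∈) | inj₁ k′Ek″      = inj₂ (k∈ , closed k′Ek″ k′∈)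
    ... | inj₂ (k∈ , _)   | inj₂ (_ , k″∈)  = inj₂ (k∈ , k″∈)

  Acted : History → Pred exTrN 0ℓ
  Acted H k = ∃[ i ] ∃[ a ] H i ≡ just (k , acted a)

  -- The classes of `E` that meet the process. Apart from a fresh name, a merge or a commit affects
  -- no others.
  Live : Config → Pred TrN 0ℓ
  Live C k = ∃[ l ] l ∈ ftn (proc C) × (l ≡ k ⊎ E C l k)

  -- Holds of all reachable configurations, though not of all configurations.
  Sound : Config → Set
  Sound C = ∀ {k} → Live C (ext k) → k ∈ Acted (H C)

  acted-uncommitted : ∀ C {k} → k ∈ Acted (H C) → k ∉ Hasco (H C)
  acted-uncommitted C (i , a , eq) (j , eq′) with refl ← H-unique C eq eq′
    with () ← ≡.trans (≡.sym eq) eq′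

  Live-E : ∀ C {k l} → E C k l → k ∈ Live C → l ∈ Live C
  Live-E C kEl (m , m∈ , inj₁ refl) = m , m∈ , inj₂ kEl
  Live-E C kEl (m , m∈ , inj₂ mEk)  = m , m∈ , inj₂ (IsPartialEquivalence.trans (E-per C) mEk kEl)

  module _ (C C′ : Config) {k : TrN} {μ : Pre Chan} {σ : TrSub} (k♯ : k ♯Δ C)
           (t : proc C ⟶⟨ k ⟨ μ ⟩ ⨟ σ ⟩ proc C′) where

    -- The set to split by consists of `k` and the live names: the domain of `σ` occurs in the
    -- process, and freshness of `k` makes the set closed under `E`.
    merged : ∀ {l l′} → (σ ⦅ E C ⦆) l l′ →
             E C l l′ ⊎ ((l ≡ k ⊎ l ∈ Live C) × (l′ ≡ k ⊎ l′ ∈ Live C))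
    merged F with ls , refl ← ⟶-range t =
      σ⦅⦆-split {N = λ l → l ≡ k ⊎ l ∈ Live C} (E-per C) closed (inj₁ refl)
        (λ l∈ → inj₂ (_ , ⟶-dom t l∈ , inj₁ refl)) F
      where
      closed : ∀ {l l′} → E C l l′ → l ≡ k ⊎ l ∈ Live C → l′ ≡ k ⊎ l′ ∈ Live C
      closed lEl′ (inj₁ refl) = ⊥-elim (proj₁ k♯ _ lEl′)
      closed lEl′ (inj₂ live) = inj₂ (Live-E C lEl′ live)

    -- New process names come from the range of `σ`, which is `k` alone, and by `merged` every new
    -- link stays within `k` and the live names.
    merged-live : E C′ ⇔ʳ (σ ⦅ E C ⦆) → ∀ {l} → l ∈ Live C′ → l ≡ k ⊎ l ∈ Live C
    merged-live sameE (m , m∈ , link) with ls , refl ← ⟶-range t | ⟶-ftn t m∈ | link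
    ... | inj₁ m∈ | inj₁ eq  = inj₂ (m , m∈ , inj₁ eq)
    ... | inj₂ eq | inj₁ refl = inj₁ eq
    ... | m-from  | inj₂ F with merged (proj₁ sameE F)
    ...   | inj₂ (_ , l-from) = l-from
    ...   | inj₁ mEl = Sum.[ (λ m∈ → inj₂ (m , m∈ , inj₂ mEl))
                           , (λ { refl → ⊥-elim (proj₁ k♯ _ mEl) }) ] m-from

  Extends-other : ∀ {h H H′} → Extends H h H′ → ∀ {i e} → H i ≡ just e → H′ i ≡ just e
  Extends-other {H = H} (i , free , _ , rest) {j} eq =
    ≡.trans (rest j λ { refl → nothing≢just (≡.trans (≡.sym free) eq) }) eq
    where
    nothing≢just : ∀ {e : exTrN × Status} → nothing ≢ just e
    nothing≢just ()

  -- A name that is live afterwards lies outside the class of `k`: otherwise the process name `m`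
  -- witnessing its liveness would be related to `k`, hence equal to it by `E-ftn`, whereas `k` has
  -- left the process. Its entry is therefore spared.
  resolved-sound : ∀ C C′ {s k} → Sound C → Resolves k (proc C) (proc C′) → Resolve s k C C′ →
                   Sound C′
  resolved-sound C C′ {s} {k} sound (resolves k∈ k∉ ftn⊆) (sameE , update) (m , m∈ , link) =
    still-acted (update _) (proj₂ (proj₂ act-k))
    where
    module Per = IsPartialEquivalence (E-per C)
    link′ : m ≡ ext _ ⊎ E C m (ext _)
    link′ = map₂ (proj₁ sameE) link
    act-k : _ ∈ Acted (H C)
    act-k = sound (m , ftn⊆ m∈ , link′)
    outside : ¬ E C k (ext _)
    outside kEl = k∉ (subst (_∈ ftn (proc C′)) (≡.sym (E-ftn C kEm k∈ (ftn⊆ m∈))) m∈)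
      where
      kEm : E C k m
      kEm = Sum.[ (λ { refl → kEl }) , (λ mEl → Per.trans kEl (Per.sym mEl)) ] link′
    still-acted : ∀ {i a} → Update (Eext (E C) k) s (H C i) (H C′ i) →
                  H C i ≡ just (_ , acted a) → _ ∈ Acted (H C′)
    still-acted {i} upd eq with H C i | H C′ i in eq′ | upd
    still-acted {i} upd refl | _ | _ | affected l∈ = ⊥-elim (outside l∈)
    still-acted {i} upd refl | _ | _ | spared _ = i , _ , eq′

  —→-sound : ∀ {C C′ ζ s} → C —[ ζ ]→⟨ s ⟩ C′ → Sound C → Sound C′
  —→-sound (silent t (sameE , sameH)) sound (m , m∈ , link)
    with inj₁ m∈ ← ⟶-ftn t m∈ with i , a , eq ← sound (m , m∈ , map₂ (proj₁ sameE) link) =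
    i , a , ≡.trans (sameH i) eq
  —→-sound {C} {C′} (internal t fresh sameE sameH) sound live
    with inj₂ live ← merged-live C C′ fresh t sameE live with i , a , eq ← sound live =
    i , a , ≡.trans (sameH i) eq
  —→-sound {C} (activate {k = k} t fresh (sameE , sameH)) sound (m , m∈ , link)
    with new-ftn t m∈ | link
  ... | inj₂ refl | inj₂ F = ⊥-elim (proj₁ fresh _ (proj₁ sameE F))
  ... | inj₁ m∈   | _ with i , a , eq ← sound (m , m∈ , map₂ (proj₁ sameE) link) =
    i , a , ≡.trans (sameH i) eq
  —→-sound {C} {C′} (abort t upd) sound =
    resolved-sound C C′ sound (abort-resolves t (IsProcess.wellFormed (isProcess C))) upd
  —→-sound {C} {C′} (visible t fresh sameE H+) sound live with merged-live C C′ fresh t sameE live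
  ... | inj₁ refl = proj₁ H+ , _ , proj₁ (proj₂ (proj₂ H+))
  ... | inj₂ live with i , a , eq ← sound live = i , a , Extends-other H+ eq
  —→-sound {C} {C′} (ignored eq fresh k∉ sameE H+) sound (m , m∈ , link)
    with subst (λ P → m ∈ ftn P) eq m∈ | map₂ (proj₁ sameE) link
  -- The new class is the singleton of `k`, so it could be live only if `k` occurred in the process.
  ... | m∈ | inj₂ (inj₂ (refl , _)) = ⊥-elim (k∉ m∈)
  ... | m∈ | inj₁ eq with i , a , eq ← sound (m , m∈ , inj₁ eq) = i , a , Extends-other H+ eq
  ... | m∈ | inj₂ (inj₁ F) with i , a , eq ← sound (m , m∈ , inj₂ F) = i , a , Extends-other H+ eq
  —→-sound {C} {C′} (commit-e t upd) sound =
    resolved-sound C C′ sound (commit-resolves t (IsProcess.wellFormed (isProcess C))) upd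
  —→-sound {C} {C′} (commit-c t upd _ _) sound =
    resolved-sound C C′ sound (commit-resolves t (IsProcess.wellFormed (isProcess C))) upd
  —→-sound {C} {C′} (commit-τ t upd _) sound =
    resolved-sound C C′ sound (commit-resolves t (IsProcess.wellFormed (isProcess C))) upd

module Translations (em : ExcludedMiddle (lsuc 0ℓ)) (S : Signature) where
  open Signature S
  open TCCS S
  open Config
  open Formulae S
  open Names S

  em₀ : ExcludedMiddle 0ℓ
  em₀ {P} = map′ lower lift (em {Lift (lsuc 0ℓ) P})

  -- Effect of a transition on `E` and on the history

  Update-names⁺ : ∀ {N s h h′ k t} → Update N s h h′ → h ≡ just (k , t) → ∃[ u ] h′ ≡ just (k , u)
  Update-names⁺ (affected _) refl = _ , refl
  Update-names⁺ (spared _)   refl = _ , refl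
  Update-names⁺ aborted      refl = _ , refl
  Update-names⁺ committed    refl = _ , refl

  Update-names⁻ : ∀ {N s h h′ k t} → Update N s h h′ → h′ ≡ just (k , t) → ∃[ u ] h ≡ just (k , u)
  Update-names⁻ (affected _) refl = _ , refl
  Update-names⁻ (spared _)   refl = _ , refl
  Update-names⁻ aborted      refl = _ , refl
  Update-names⁻ committed    refl = _ , refl

  Update-committed⁺ : ∀ {N s h h′ k} → Update N s h h′ → h ≡ just (k , committed) →
                      h′ ≡ just (k , committed)
  Update-committed⁺ committed refl = refl

  Update-committed⁻ : ∀ {N s h h′ k} → Update N s h h′ → h′ ≡ just (k , committed) →
                      h ≡ just (k , committed) ⊎ (s ≡ committed × k ∈ N)
  Update-committed⁻ (affected k∈) refl = inj₂ (refl , k∈)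
  Update-committed⁻ committed     refl = inj₁ refl

  Update-acted : ∀ {N s h h′ k a} → Update N s h h′ → h ≡ just (k , acted a) → k ∈ N →
                 h′ ≡ just (k , s)
  Update-acted (affected _) refl k∈ = refl
  Update-acted (spared k∉)  refl k∈ = ⊥-elim (k∉ k∈)

  Extends-new : ∀ {h H H′} → Extends H h H′ → ∀ {i e} → H′ i ≡ just e → e ≡ h ⊎ H i ≡ just e
  Extends-new (i , free , at-i , rest) {j} eq with em₀ {j ≡ i}
  ... | no j≢i = inj₂ (≡.trans (≡.sym (rest j j≢i)) eq)
  ... | yes refl with refl ← ≡.trans (≡.sym eq) at-i = inj₁ refl

  E-mono : ∀ {C D ζ s} → C —[ ζ ]→⟨ s ⟩ D → ∀ {k l} → E C k l → E D k l
  E-mono (silent _ (sameE , _)) F = proj₂ sameE F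
  E-mono (internal _ _ sameE _) F = proj₂ sameE (base F)
  E-mono (activate _ _ (sameE , _)) F = proj₂ sameE F
  E-mono (abort _ (sameE , _)) F = proj₂ sameE F
  E-mono (visible _ _ sameE _) F = proj₂ sameE (base F)
  E-mono (ignored _ _ _ sameE _) F = proj₂ sameE (inj₁ F)
  E-mono (commit-e _ (sameE , _)) F = proj₂ sameE F
  E-mono (commit-c _ (sameE , _) _ _) F = proj₂ sameE F
  E-mono (commit-τ _ (sameE , _) _) F = proj₂ sameE F

  names-mono : ∀ {C D ζ s} → C —[ ζ ]→⟨ s ⟩ D → Hᵗʳⁿ (H C) ⊆ Hᵗʳⁿ (H D)
  names-mono (silent _ (_ , sameH)) (i , t , eq) = i , t , ≡.trans (sameH i) eq
  names-mono (internal _ _ _ sameH) (i , t , eq) = i , t , ≡.trans (sameH i) eq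
  names-mono (activate _ _ (_ , sameH)) (i , t , eq) = i , t , ≡.trans (sameH i) eq
  names-mono (abort _ (_ , update)) (i , _ , eq) = i , Update-names⁺ (update i) eq
  names-mono (visible _ _ _ H+) (i , t , eq) = i , t , Extends-other H+ eq
  names-mono (ignored _ _ _ _ H+) (i , t , eq) = i , t , Extends-other H+ eq
  names-mono (commit-e _ (_ , update)) (i , _ , eq) = i , Update-names⁺ (update i) eq
  names-mono (commit-c _ (_ , update) _ _) (i , _ , eq) = i , Update-names⁺ (update i) eq
  names-mono (commit-τ _ (_ , update) _) (i , _ , eq) = i , Update-names⁺ (update i) eq

  committed-mono : ∀ {C D ζ s} → C —[ ζ ]→⟨ s ⟩ D → Hasco (H C) ⊆ Hasco (H D)
  committed-mono (silent _ (_ , sameH)) (i , eq) = i , ≡.trans (sameH i) eq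
  committed-mono (internal _ _ _ sameH) (i , eq) = i , ≡.trans (sameH i) eq
  committed-mono (activate _ _ (_ , sameH)) (i , eq) = i , ≡.trans (sameH i) eq
  committed-mono (abort _ (_ , update)) (i , eq) = i , Update-committed⁺ (update i) eq
  committed-mono (visible _ _ _ H+) (i , eq) = i , Extends-other H+ eq
  committed-mono (ignored _ _ _ _ H+) (i , eq) = i , Extends-other H+ eq
  committed-mono (commit-e _ (_ , update)) (i , eq) = i , Update-committed⁺ (update i) eq
  committed-mono (commit-c _ (_ , update) _ _) (i , eq) = i , Update-committed⁺ (update i) eq
  committed-mono (commit-τ _ (_ , update) _) (i , eq) = i , Update-committed⁺ (update i) eq

  introducedBy committedBy : Obs → Pred exTrN 0ℓ
  introducedBy (l ⟨ a ⟩) k = k ≡ l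
  introducedBy τ         k = ⊥
  introducedBy (co K)    k = ⊥
  committedBy (co K)    = K
  committedBy τ         = ∅
  committedBy (l ⟨ a ⟩) = ∅

  names-new : ∀ {C D ζ s} → C —[ ζ ]→⟨ s ⟩ D →
              ∀ {k} → k ∈ Hᵗʳⁿ (H D) → k ∈ introducedBy ζ ⊎ k ∈ Hᵗʳⁿ (H C)
  names-new (silent _ (_ , sameH)) (i , t , eq) = inj₂ (i , t , ≡.trans (≡.sym (sameH i)) eq)
  names-new (internal _ _ _ sameH) (i , t , eq) = inj₂ (i , t , ≡.trans (≡.sym (sameH i)) eq)
  names-new (activate _ _ (_ , sameH)) (i , t , eq) =
    inj₂ (i , t , ≡.trans (≡.sym (sameH i)) eq)
  names-new (abort _ (_ , update)) (i , _ , eq) = inj₂ (i , Update-names⁻ (update i) eq)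
  names-new (visible _ _ _ H+) (i , t , eq) =
    Sum.map (λ { refl → refl }) (λ eq → i , t , eq) (Extends-new H+ eq)
  names-new (ignored _ _ _ _ H+) (i , t , eq) =
    Sum.map (λ { refl → refl }) (λ eq → i , t , eq) (Extends-new H+ eq)
  names-new (commit-e _ (_ , update)) (i , _ , eq) = inj₂ (i , Update-names⁻ (update i) eq)
  names-new (commit-c _ (_ , update) _ _) (i , _ , eq) = inj₂ (i , Update-names⁻ (update i) eq)
  names-new (commit-τ _ (_ , update) _) (i , _ , eq) = inj₂ (i , Update-names⁻ (update i) eq)

  introduced : ∀ {C D l a s} → C —[ l ⟨ a ⟩ ]→⟨ s ⟩ D → l ∈ Hᵗʳⁿ (H D) × l ∉ Hᵗʳⁿ (H C)
  introduced (visible _ fresh _ (i , _ , at-i , _)) = (i , _ , at-i) , λ l∈ → proj₂ fresh _ l∈ refl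
  introduced (ignored _ fresh _ _ (i , _ , at-i , _)) =
    (i , _ , at-i) , λ l∈ → proj₂ fresh _ l∈ refl

  -- This is specific to `c`, where a commit of external names shows up in the label; in `e` the
  -- same step is labelled `τ`.
  committed-new : ∀ {C D ζ} → C —[ ζ ]→⟨ c ⟩ D →
                  ∀ {k} → k ∈ Hasco (H D) → k ∈ Hasco (H C) ⊎ k ∈ committedBy ζ
  committed-new (silent _ (_ , sameH)) (i , eq) = inj₁ (i , ≡.trans (≡.sym (sameH i)) eq)
  committed-new (internal _ _ _ sameH) (i , eq) = inj₁ (i , ≡.trans (≡.sym (sameH i)) eq)
  committed-new (activate _ _ (_ , sameH)) (i , eq) = inj₁ (i , ≡.trans (≡.sym (sameH i)) eq)
  committed-new (abort _ (_ , update)) (i , eq) with inj₁ eq ← Update-committed⁻ (update i) eq =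
    inj₁ (i , eq)
  committed-new (visible _ _ _ H+) (i , eq) with inj₂ eq ← Extends-new H+ eq = inj₁ (i , eq)
  committed-new (ignored _ _ _ _ H+) (i , eq) with inj₂ eq ← Extends-new H+ eq = inj₁ (i , eq)
  committed-new (commit-c _ (_ , update) _ K≐) (i , eq) with Update-committed⁻ (update i) eq
  ... | inj₁ eq       = inj₁ (i , eq)
  ... | inj₂ (_ , k∈) = inj₂ (proj₂ K≐ k∈)
  committed-new (commit-τ _ (_ , update) none) (i , eq) with Update-committed⁻ (update i) eq
  ... | inj₁ eq       = inj₁ (i , eq)
  ... | inj₂ (_ , k∈) = ⊥-elim (none _ k∈)

  co-related : ∀ {C D K} → C —[ co K ]→⟨ c ⟩ D → ∀ {k l} → k ∈ K → l ∈ K → E C (ext k) (ext l)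
  co-related {C} (commit-c _ _ _ (K⊆ , _)) k∈ l∈ = Per.trans (Per.sym (K⊆ k∈)) (K⊆ l∈)
    where module Per = IsPartialEquivalence (E-per C)

  co-closed : ∀ {C D K} → C —[ co K ]→⟨ c ⟩ D → ∀ {k l} → k ∈ K → E D (ext k) (ext l) → l ∈ K
  co-closed {C} (commit-c _ (sameE , _) _ (K⊆ , K⊇)) k∈ F =
    K⊇ (IsPartialEquivalence.trans (E-per C) (K⊆ k∈) (proj₁ sameE F))

  co-satisfiable : ∀ {C D K} → C —[ co K ]→⟨ c ⟩ D → Satisfiable K
  co-satisfiable (commit-c _ _ (l , l∈) (_ , K⊇)) = l , K⊇ l∈

  co-named : ∀ {C D K} → C —[ co K ]→⟨ c ⟩ D → K ⊆ Hᵗʳⁿ (H C)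
  co-named {C} t k∈ = Equivalence.to (E-H C _) (co-related t k∈ k∈)

  -- The transaction being committed occurs in the process, so its whole class is live and `Sound`
  -- applies to each external name in it. This ensures that the commit really changes every entry of
  -- `K`.
  co-acted : ∀ {C D K} → C —[ co K ]→⟨ c ⟩ D → Sound C → K ⊆ Acted (H C)
  co-acted {C} (commit-c u _ _ (K⊆ , _)) sound k∈
    with resolves l∈ _ _ ← commit-resolves u (IsProcess.wellFormed (isProcess C)) =
    sound (_ , l∈ , inj₂ (K⊆ k∈))

  co-uncommitted : ∀ {C D K} → C —[ co K ]→⟨ c ⟩ D → Sound C → ∀ {k} → k ∈ K → k ∉ Hasco (H C)
  co-uncommitted {C} t sound k∈ = acted-uncommitted C (co-acted t sound k∈)

  co-committed : ∀ {C D K} → C —[ co K ]→⟨ c ⟩ D → Sound C → K ⊆ Hasco (H D)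
  co-committed t@(commit-c _ (_ , update) _ (K⊆ , _)) sound k∈
    with i , _ , eq ← co-acted t sound k∈ = i , Update-acted (update i) eq (K⊆ k∈)

  -- Transactions of committed names are no longer live, so they take no part in merges.
  E-committed : ∀ {C D ζ s} → Sound C → C —[ ζ ]→⟨ s ⟩ D →
                ∀ {k l} → k ∈ Hasco (H C) → E D (ext k) (ext l) → E C (ext k) (ext l)
  E-committed sound (silent _ (sameE , _)) k∈ F = proj₁ sameE F
  E-committed {C} {D} sound (internal t fresh sameE _) k∈ F with merged C D fresh t (proj₁ sameE F)
  ... | inj₁ F = F
  ... | inj₂ (inj₂ live , _) = ⊥-elim (acted-uncommitted C (sound live) k∈)
  E-committed sound (activate _ _ (sameE , _)) k∈ F = proj₁ sameE F
  E-committed sound (abort _ (sameE , _)) k∈ F = proj₁ sameE F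
  E-committed {C} {D} sound (visible t fresh sameE _) k∈ F with merged C D fresh t (proj₁ sameE F)
  ... | inj₁ F = F
  ... | inj₂ (inj₁ refl , _) = ⊥-elim (proj₂ fresh _ (proj₁ k∈ , _ , proj₂ k∈) refl)
  ... | inj₂ (inj₂ live , _) = ⊥-elim (acted-uncommitted C (sound live) k∈)
  E-committed sound (ignored _ fresh _ sameE _) k∈ F with proj₁ sameE F
  ... | inj₁ F = F
  ... | inj₂ (refl , _) = ⊥-elim (proj₂ fresh _ (proj₁ k∈ , _ , proj₂ k∈) refl)
  E-committed sound (commit-e _ (sameE , _)) k∈ F = proj₁ sameE F
  E-committed sound (commit-c _ (sameE , _) _ _) k∈ F = proj₁ sameE F
  E-committed sound (commit-τ _ (sameE , _) _) k∈ F = proj₁ sameE F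

  CoEq : Config → Rel exTrN 0ℓ
  CoEq C k l = (k ∈ Hasco (H C) × l ∈ Hasco (H C)) × E C (ext k) (ext l)

  CoEq-mono : ∀ {C D ζ s} → C —[ ζ ]→⟨ s ⟩ D → ∀ {k l} → CoEq C k l → CoEq D k l
  CoEq-mono t ((k∈ , l∈) , F) = (committed-mono t k∈ , committed-mono t l∈) , E-mono t F

  -- The class of an already committed name does not grow, and the class of a newly committed one is
  -- the set shown in the label. So the label determines how `=co` changes.
  CoEq-new : ∀ {C D ζ} → Sound C → C —[ ζ ]→⟨ c ⟩ D → ∀ {k l} → CoEq D k l →
             CoEq C k l ⊎ (k ∈ committedBy ζ × l ∈ committedBy ζ)
  CoEq-new {C} {ζ = ζ} sound t ((k∈ , l∈) , F) with committed-new t k∈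
  ... | inj₁ k∈ with F ← E-committed sound t k∈ F =
    inj₁ ((k∈ , Equivalence.to (E-Hasco C F) k∈) , F)
  CoEq-new {ζ = co K} sound t (_ , F) | inj₂ k∈K = inj₂ (k∈K , co-closed t k∈K F)

  CoEq-co : ∀ {C D K} → Sound C → C —[ co K ]→⟨ c ⟩ D → ∀ {k l} → k ∈ K → l ∈ K → CoEq D k l
  CoEq-co sound t k∈ l∈ =
    (co-committed t sound k∈ , co-committed t sound l∈) , E-mono t (co-related t k∈ l∈)

  relabel : ∀ {C D K K′} → K ≐ K′ → C —[ co K ]→⟨ c ⟩ D → C —[ co K′ ]→⟨ c ⟩ D
  relabel (K⊆ , K⊇) (commit-c t upd some (to , from)) =
    commit-c t upd some ((λ k∈ → to (K⊇ k∈)) , (λ k∈ → K⊆ (from k∈)))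

  relabel-⇒ : ∀ {C D K K′} → K ≐ K′ → C =[ co K ]⇒⟨ c ⟩ D → C =[ co K′ ]⇒⟨ c ⟩ D
  relabel-⇒ eq (_ , _ , ts , t , us) = _ , _ , ts , relabel eq t , us

  -- Comparison of the two transition relations

  act-step : ∀ {C D l a s s′} → C —[ l ⟨ a ⟩ ]→⟨ s ⟩ D → C —[ l ⟨ a ⟩ ]→⟨ s′ ⟩ D
  act-step (visible t fresh sameE H+)    = visible t fresh sameE H+
  act-step (ignored eq fresh k∉ sameE H+) = ignored eq fresh k∉ sameE H+

  e-step : ∀ {C D} → C —[ τ ]→⟨ e ⟩ D →
           C —[ τ ]→⟨ c ⟩ D ⊎ ∃[ K ] C —[ co K ]→⟨ c ⟩ D
  e-step (silent t same) = inj₁ (silent t same)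
  e-step (internal t fresh sameE sameH) = inj₁ (internal t fresh sameE sameH)
  e-step (activate t fresh same) = inj₁ (activate t fresh same)
  e-step (abort t upd) = inj₁ (abort t upd)
  e-step {C} (commit-e {k = k} t upd) with em₀ {Satisfiable (Eext (E C) k)}
  ... | yes some = inj₂ (_ , commit-c t upd some (id , id))
  ... | no none  = inj₁ (commit-τ t upd (λ l l∈ → none (l , l∈)))

  c-step : ∀ {C D} → C —[ τ ]→⟨ c ⟩ D → C —[ τ ]→⟨ e ⟩ D
  c-step (silent t same) = silent t same
  c-step (internal t fresh sameE sameH) = internal t fresh sameE sameH
  c-step (activate t fresh same) = activate t fresh same
  c-step (abort t upd) = abort t upd
  c-step (commit-τ t upd _) = commit-e t upd

  co-step : ∀ {C D K} → C —[ co K ]→⟨ c ⟩ D → C —[ τ ]→⟨ e ⟩ D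
  co-step (commit-c t upd _ _) = commit-e t upd

  c-steps : ∀ {C D} → C =[τ]⇒⟨ c ⟩ D → C =[τ]⇒⟨ e ⟩ D
  c-steps []       = []
  c-steps (t ◅ ts) = c-step t ◅ c-steps ts

  steps-E : ∀ {C D s} → C =[τ]⇒⟨ s ⟩ D → ∀ {k l} → E C k l → E D k l
  steps-E []       F = F
  steps-E (t ◅ ts) F = steps-E ts (E-mono t F)

  steps-committed : ∀ {C D s} → C =[τ]⇒⟨ s ⟩ D → Hasco (H C) ⊆ Hasco (H D)
  steps-committed []       k∈ = k∈
  steps-committed (t ◅ ts) k∈ = steps-committed ts (committed-mono t k∈)

  c-steps-committed : ∀ {C D} → C =[τ]⇒⟨ c ⟩ D → Hasco (H D) ⊆ Hasco (H C)
  c-steps-committed []       k∈ = k∈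
  c-steps-committed (t ◅ ts) k∈ with inj₁ k∈ ← committed-new t (c-steps-committed ts k∈) = k∈

  -- Variables as the names of the history

  record Tracks {n} (ρ : Vec exTrN n) (C : Config) : Set where
    field
      sound     : Sound C
      covers    : ∀ {k} → k ∈ Hᵗʳⁿ (H C) → ∃[ x ] lookup ρ x ≡ k
      named     : ∀ x → lookup ρ x ∈ Hᵗʳⁿ (H C)
      injective : ∀ {x y} → lookup ρ x ≡ lookup ρ y → x ≡ y

  open Tracks

  tracks-step : ∀ {n} {ρ : Vec exTrN n} {C D ζ s} → Tracks ρ C → C —[ ζ ]→⟨ s ⟩ D →
                (∀ k → k ∉ introducedBy ζ) → Tracks ρ D
  tracks-step tr t none = record
    { sound     = —→-sound t (sound tr)
    ; covers    = λ k∈ → covers tr (Sum.[ (λ k∈ → ⊥-elim (none _ k∈)) , id ] (names-new t k∈))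
    ; named     = λ x → names-mono t (named tr x)
    ; injective = injective tr
    }

  tracks-act : ∀ {n} {ρ : Vec exTrN n} {C D l a s} → Tracks ρ C → C —[ l ⟨ a ⟩ ]→⟨ s ⟩ D →
               Tracks (l ∷ ρ) D
  tracks-act {ρ = ρ} {C} {D} {l} tr t = record
    { sound     = —→-sound t (sound tr)
    ; covers    = λ k∈ → Sum.[ (λ { refl → zero , refl }) , old ] (names-new t k∈)
    ; named     = λ { zero → proj₁ (introduced t) ; (suc x) → names-mono t (named tr x) }
    ; injective = inj
    }
    where
    old : ∀ {k} → k ∈ Hᵗʳⁿ (H C) → ∃[ x ] lookup (l ∷ ρ) x ≡ k
    old k∈ with x , eq ← covers tr k∈ = suc x , eq
    inj : ∀ {x y} → lookup (l ∷ ρ) x ≡ lookup (l ∷ ρ) y → x ≡ y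
    inj {zero}  {zero}  eq   = refl
    inj {zero}  {suc y} refl = ⊥-elim (proj₂ (introduced t) (named tr y))
    inj {suc x} {zero}  refl = ⊥-elim (proj₂ (introduced t) (named tr x))
    inj {suc x} {suc y} eq   = cong suc (injective tr eq)

  tracks-steps : ∀ {n} {ρ : Vec exTrN n} {C D s} → Tracks ρ C → C =[τ]⇒⟨ s ⟩ D → Tracks ρ D
  tracks-steps tr []       = tr
  tracks-steps tr (t ◅ ts) = tracks-steps (tracks-step tr t λ _ ()) ts

  tracks-⇒act : ∀ {n} {ρ : Vec exTrN n} {C D l a s} → Tracks ρ C → C =[ l ⟨ a ⟩ ]⇒⟨ s ⟩ D →
                Tracks (l ∷ ρ) D
  tracks-⇒act tr (_ , _ , ts , t , us) =
    tracks-steps (tracks-act (tracks-steps tr ts) t) us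

  tracks-⇒co : ∀ {n} {ρ : Vec exTrN n} {C D K s} → Tracks ρ C → C =[ co K ]⇒⟨ s ⟩ D → Tracks ρ D
  tracks-⇒co tr (_ , _ , ts , t , us) =
    tracks-steps (tracks-step (tracks-steps tr ts) t λ _ ()) us

  -- Exchanging fresh names

  transposition : exTrN → exTrN → exTrN → exTrN
  transposition l m k with k ≟ex l | k ≟ex m
  ... | yes _ | _     = m
  ... | no _  | yes _ = l
  ... | no _  | no _  = k

  transposition-left : ∀ l m → transposition l m l ≡ m
  transposition-left l m with l ≟ex l
  ... | yes _  = refl
  ... | no l≢l = contradiction refl l≢l

  transposition-right : ∀ l m → transposition l m m ≡ l
  transposition-right l m with m ≟ex l | m ≟ex m
  ... | yes m≡l | _      = m≡l
  ... | no _    | yes _  = refl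
  ... | no _    | no m≢m = contradiction refl m≢m

  transposition-fixes : ∀ l m k → k ≢ l → k ≢ m → transposition l m k ≡ k
  transposition-fixes l m k k≢l k≢m with k ≟ex l | k ≟ex m
  ... | yes k≡l | _       = contradiction k≡l k≢l
  ... | no _    | yes k≡m = contradiction k≡m k≢m
  ... | no _    | no _    = refl

  transposition-involutive : ∀ l m k → transposition l m (transposition l m k) ≡ k
  transposition-involutive l m k with k ≟ex l | k ≟ex m
  ... | yes k≡l | _       = ≡.trans (transposition-right l m) (≡.sym k≡l)
  ... | no _    | yes k≡m = ≡.trans (transposition-left l m) (≡.sym k≡m)
  ... | no k≢l  | no k≢m  = transposition-fixes l m k k≢l k≢m

  Fresh : ∀ {n} → Vec exTrN n → Pred exTrN 0ℓ
  Fresh ρ l = ∀ x → lookup ρ x ≢ l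

  names : ∀ {n} → Vec exTrN n → List exTrN
  names ρ = tabulate (lookup ρ)

  fresh : ∀ {n} (ρ : Vec exTrN n) {l} → l ∉ˡ names ρ → l ∈ Fresh ρ
  fresh ρ l∉ x refl = l∉ (∈-tabulate⁺ x)

  -- A list covering all of `exTrN` would contain the image of an injection from `ℕ`, which `finite`
  -- refutes.
  fresh-for : ∀ xs → ∃[ l ] l ∉ˡ xs
  fresh-for xs with em₀ {∃[ l ] l ∉ˡ xs}
  ... | yes l   = l
  ... | no none = ⊥-elim (finite exTrN-infinite xs
          (λ i → decidable-stable em₀ (λ i∉ → none (_ , i∉))))

  act-fresh : ∀ {n} {ρ : Vec exTrN n} {C D l a s} → Tracks ρ C → C =[ l ⟨ a ⟩ ]⇒⟨ s ⟩ D →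
              l ∈ Fresh ρ
  act-fresh tr (_ , _ , ts , t , _) x refl = proj₂ (introduced t) (named (tracks-steps tr ts) x)

  module _ {n} {ρ : Vec exTrN n} {C : Config} (tr : Tracks ρ C) {l m : exTrN}
           (l-fresh : l ∈ Fresh ρ) (m-fresh : m ∈ Fresh ρ) where
    private
      f = transposition l m
      module R = Renaming S f (transposition-involutive l m)

    fixes-named : ∀ {k} → k ∈ Hᵗʳⁿ (H C) → f k ≡ k
    fixes-named k∈ with x , refl ← covers tr k∈ = transposition-fixes l m _ (l-fresh x) (m-fresh x)

    fixes-E : ∀ {k} → E C k k → R.π k ≡ k
    fixes-E {int k} F = refl
    fixes-E {ext k} F = cong ext (fixes-named (Equivalence.to (E-H C k) F))

    -- Every external name of `C` is in its history: those of the process by `ftn-ext`, those in the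
    -- domain of `E` by `E-H`. The history names are values of `ρ`, and the transposition moves none
    -- of them.
    self : C R.≅ C
    self = record
      { proc≃ = R.≃-refl (proc C) λ { {int k} _ → refl
                                    ; {ext k} k∈ → cong ext (fixes-named (ftn-ext C k∈)) }
      ; E≅    = E-fixed
      ; E≅⁻   = E-fixed
      ; H≅    = λ i → H-fixed i (H C i) refl
      }
      where
      module Per = IsPartialEquivalence (E-per C)
      E-fixed : ∀ {k k′} → E C k k′ → E C (R.π k) (R.π k′)
      E-fixed F = subst₂ (E C) (≡.sym (fixes-E (Per.trans F (Per.sym F))))
                               (≡.sym (fixes-E (Per.trans (Per.sym F) F))) F
      H-fixed : ∀ i h → H C i ≡ h → H C i ≡ R.πEntry (H C i)
      H-fixed i nothing        eq rewrite eq = refl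
      H-fixed i (just (k , s)) eq rewrite eq =
        cong (λ l → just (l , s)) (≡.sym (fixes-named (i , s , eq)))

  -- By equivariance under the transposition of two fresh names, one fresh name is as good as another.
  some-any : ∀ {ℒ n} (φ : Pure ℒ (suc n)) {ρ : Vec exTrN n} {C C′ l a s} → Tracks ρ C →
             C =[ l ⟨ a ⟩ ]⇒⟨ s ⟩ C′ → C′ ⊨[ l ∷ ρ ] ⌊ φ ⌋ → ∀ {m} → m ∈ Fresh ρ →
             ∃[ D ] C =[ m ⟨ a ⟩ ]⇒⟨ s ⟩ D × D ⊨[ m ∷ ρ ] ⌊ φ ⌋
  some-any φ {ρ} {C} {l = l} {a} {s} tr ts sat {m} m-fresh
    with D , us , C′≅D ← Renaming.≅-⇒ S _ (transposition-involutive l m) ts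
                           (self tr (act-fresh tr ts) m-fresh) (Renaming._⟨_⟩ l a) =
    D , subst (λ k → C =[ k ⟨ a ⟩ ]⇒⟨ s ⟩ D) (transposition-left l m) us ,
    Renaming.≅-⊨ S _ (transposition-involutive l m) φ env C′≅D sat
    where
    env : ∀ x → lookup (m ∷ ρ) x ≡ transposition l m (lookup (l ∷ ρ) x)
    env zero    = ≡.sym (transposition-left l m)
    env (suc x) = ≡.sym (transposition-fixes l m _ (act-fresh tr ts x) (m-fresh x))

  -- Together with `⟨x⟩⇒some` this is the some/any property of a freshness quantifier: for pure
  -- formulae the cofinite condition may be treated as an existential one.
  some⇒⟨x⟩ : ∀ {ℒ n a} (φ : Pure ℒ (suc n)) {ρ : Vec exTrN n} {C C′ l} → Tracks ρ C →
             C =[ l ⟨ a ⟩ ]⇒⟨ sem ℒ ⟩ C′ → C′ ⊨[ l ∷ ρ ] ⌊ φ ⌋ → C ⊨[ ρ ] ⌊ ⟨x⟨ a ⟩⟩ φ ⌋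
  some⇒⟨x⟩ φ {ρ} tr ts sat = names ρ , λ m m∉ → some-any φ tr ts sat (fresh ρ m∉)

  ⟨x⟩⇒some : ∀ {ℒ n a} (φ : Formula ℒ (suc n)) {ρ : Vec exTrN n} {C} → C ⊨[ ρ ] (⟨x⟨ a ⟩⟩ φ) →
             ∃[ l ] ∃[ C′ ] C =[ l ⟨ a ⟩ ]⇒⟨ sem ℒ ⟩ C′ × C′ ⊨[ l ∷ ρ ] φ
  ⟨x⟩⇒some φ (excl , sat) with l , l∉ ← fresh-for excl = l , sat l l∉

  -- Derived connectives and elimination of external names

  infixr 7 _∧_

  ⊤ᶠ : ∀ {ℒ n} → Pure ℒ n
  ⊤ᶠ = ⋀ ⊥ λ ()

  _∧_ : ∀ {ℒ n} → Pure ℒ n → Pure ℒ n → Pure ℒ n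
  φ ∧ ψ = ⋀ Bool λ b → if b then φ else ψ

  ⋁ : ∀ {ℒ n} (M : Set) → (M → Pure ℒ n) → Pure ℒ n
  ⋁ M φ = ∼ ⋀ M λ i → ∼ φ i

  both : {X : Bool → Set₁} → X true → X false → ∀ b → X b
  both p q true  = p
  both p q false = q

  -- The negated universal in this type is what satisfaction of `⋁` computes to.
  some⁺ : {M : Set} {X : M → Set₁} (i : M) → X i → ¬ (∀ i → ¬ X i)
  some⁺ i p none = none i p

  some⁻ : {M : Set} {X : M → Set₁} → ¬ (∀ i → ¬ X i) → ∃[ i ] X i
  some⁻ p = decidable-stable em λ none → p λ i q → none (i , q)

  -- The result is only right for configurations whose history has exactly the names ρ.  As φ may
  -- contain infinitely many names, no choice of x avoids them all: the translation of the body of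
  -- ⟨x(a)⟩ depends on the name of x.
  elim : ∀ {ℒ n} → Formula ℒ n → Vec exTrN n → Pure ℒ n
  elim (⟨τ⟩ φ) ρ = ⟨τ⟩ elim φ ρ
  elim (⟨x⟨ a ⟩⟩ φ) ρ =
    ⋁ (List exTrN) λ excl →
    ⋀ (∃[ l ] l ∉ˡ excl × l ∈ Fresh ρ) λ (l , _) →
    ⟨x⟨ a ⟩⟩ elim φ (l ∷ ρ)
  elim (∼ φ) ρ = ∼ elim φ ρ
  elim (⋀ M φ) ρ = ⋀ M λ i → elim (φ i) ρ
  elim (hasco v) ρ = ⋁ (∃[ x ] lookup ρ x ≡ value ρ v) λ (x , _) → hasco x
  elim (v =co w) ρ =
    ⋁ ((∃[ x ] lookup ρ x ≡ value ρ v) × (∃[ y ] lookup ρ y ≡ value ρ w)) λ ((x , _) , (y , _)) →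
    x =co y
  elim (⟨co K ∣ v , v∈ ⟩ φ) ρ =
    ⋁ (∀ v → v ∈ K → ∃[ x ] lookup ρ x ≡ value ρ v) λ cover →
    ⟨co (λ x → lookup ρ x ∈ valueₛ ρ K)
      ∣ proj₁ (cover v v∈) , v , v∈ , ≡.sym (proj₂ (cover v v∈)) ⟩ elim φ ρ

  Hasco⊆Hᵗʳⁿ : ∀ {H} → Hasco H ⊆ Hᵗʳⁿ H
  Hasco⊆Hᵗʳⁿ (i , eq) = i , _ , eq

  elim-sat : ∀ {ℒ n} (φ : Formula ℒ n) {ρ C} → Tracks ρ C → C ⊨[ ρ ] φ ⇔ C ⊨[ ρ ] ⌊ elim φ ρ ⌋
  elim-sat (⟨τ⟩ φ) tr = mk⇔
    (λ (C′ , ts , sat) → C′ , ts , Equivalence.to (elim-sat φ (tracks-steps tr ts)) sat)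
    (λ (C′ , ts , sat) → C′ , ts , Equivalence.from (elim-sat φ (tracks-steps tr ts)) sat)
  elim-sat {ℒ} (⟨x⟨ a ⟩⟩ φ) {ρ} {C} tr = mk⇔ to from
    where
    to : C ⊨[ ρ ] (⟨x⟨ a ⟩⟩ φ) → C ⊨[ ρ ] ⌊ elim (⟨x⟨ a ⟩⟩ φ) ρ ⌋
    to (excl , sat) = some⁺ excl λ (l , l∉ , _) →
      let C′ , ts , sat′ = sat l l∉
      in some⇒⟨x⟩ (elim φ (l ∷ ρ)) tr ts (Equivalence.to (elim-sat φ (tracks-⇒act tr ts)) sat′)
    from : C ⊨[ ρ ] ⌊ elim (⟨x⟨ a ⟩⟩ φ) ρ ⌋ → C ⊨[ ρ ] (⟨x⟨ a ⟩⟩ φ)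
    from sat with excl , sat′ ← some⁻ sat = excl ++ names ρ , witness
      where
      witness : ∀ l → l ∉ˡ excl ++ names ρ → ∃[ C′ ] C =[ l ⟨ a ⟩ ]⇒⟨ sem ℒ ⟩ C′ × C′ ⊨[ l ∷ ρ ] φ
      witness l l∉ =
        let l-fresh = fresh ρ (λ l∈ → l∉ (∈-++⁺ʳ excl l∈))
            m , _ , ts , sat″ =
              ⟨x⟩⇒some ⌊ elim φ (l ∷ ρ) ⌋ {ρ} {C} (sat′ (l , (λ l∈ → l∉ (∈-++⁺ˡ l∈)) , l-fresh))
            -- The modality was witnessed by some name `m`, whereas its body was translated for `l`.
            -- Both are fresh, so `m` can be exchanged for `l`.
            C′ , us , sat‴ = some-any (elim φ (l ∷ ρ)) tr ts sat″ l-fresh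
        in C′ , us , Equivalence.from (elim-sat φ (tracks-⇒act tr us)) sat‴
  elim-sat (∼ φ) tr = mk⇔
    (λ unsat sat → unsat (Equivalence.from (elim-sat φ tr) sat))
    (λ unsat sat → unsat (Equivalence.to (elim-sat φ tr) sat))
  elim-sat (⋀ M φ) tr = mk⇔
    (λ sat i → Equivalence.to (elim-sat (φ i) tr) (sat i))
    (λ sat i → Equivalence.from (elim-sat (φ i) tr) (sat i))
  elim-sat (hasco v) {ρ} {C} tr = mk⇔ to from
    where
    to : C ⊨[ ρ ] hasco v → C ⊨[ ρ ] ⌊ elim (hasco v) ρ ⌋
    to (lift k∈) with x , eq ← covers tr (Hasco⊆Hᵗʳⁿ k∈) =
      some⁺ (x , eq) (lift (subst (_∈ Hasco (H C)) (≡.sym eq) k∈))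
    from : C ⊨[ ρ ] ⌊ elim (hasco v) ρ ⌋ → C ⊨[ ρ ] hasco v
    from sat with (x , eq) , lift k∈ ← some⁻ sat =
      lift (subst (_∈ Hasco (H C)) eq k∈)
  elim-sat (v =co w) {ρ} {C} tr = mk⇔ to from
    where
    to : C ⊨[ ρ ] (v =co w) → C ⊨[ ρ ] ⌊ elim (v =co w) ρ ⌋
    to (lift F@((k∈ , l∈) , _))
      with x , eq ← covers tr (Hasco⊆Hᵗʳⁿ k∈) | y , eq′ ← covers tr (Hasco⊆Hᵗʳⁿ l∈) =
      some⁺ ((x , eq) , (y , eq′))
         (lift (subst₂ (CoEq C) (≡.sym eq) (≡.sym eq′) F))
    from : C ⊨[ ρ ] ⌊ elim (v =co w) ρ ⌋ → C ⊨[ ρ ] (v =co w)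
    from sat with ((x , eq) , (y , eq′)) , lift F ← some⁻ sat =
      lift (subst₂ (CoEq C) eq eq′ F)
  elim-sat {n = n} (⟨co K ∣ v , v∈ ⟩ φ) {ρ} {C} tr = mk⇔ to from
    where
    Cover : Set
    Cover = ∀ v → v ∈ K → ∃[ x ] lookup ρ x ≡ value ρ v
    K⁻ : Pred (Fin n) 0ℓ
    K⁻ x = lookup ρ x ∈ valueₛ ρ K
    K≐ : Cover → valueₛ ρ K ≐ valueₛ ρ (vars K⁻)
    K≐ cover =
      (λ { (v , v∈ , refl) → let x , eq = cover v v∈ in inj₂ x , (v , v∈ , ≡.sym eq) , eq }) ,
      (λ { (inj₂ x , x∈ , refl) → x∈ })
    to : C ⊨[ ρ ] (⟨co K ∣ v , v∈ ⟩ φ) → C ⊨[ ρ ] ⌊ elim (⟨co K ∣ v , v∈ ⟩ φ) ρ ⌋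
    to (C′ , ts@(_ , _ , us , t , _) , sat) = some⁺ cover
      (C′ , relabel-⇒ (K≐ cover) ts , Equivalence.to (elim-sat φ (tracks-⇒co tr ts)) sat)
      where
      -- Names observed in a commit are in the history at that moment and hence values of variables.
      -- If `K` mentions any other name, `Cover` is empty and the translation is false, as it should
      -- be.
      cover : Cover
      cover v v∈ = covers (tracks-steps tr us) (co-named t (v , v∈ , refl))
    from : C ⊨[ ρ ] ⌊ elim (⟨co K ∣ v , v∈ ⟩ φ) ρ ⌋ → C ⊨[ ρ ] (⟨co K ∣ v , v∈ ⟩ φ)
    from sat with cover , C′ , ts , sat′ ← some⁻ sat =
      let ts′ = relabel-⇒ (proj₂ (K≐ cover) , proj₁ (K≐ cover)) ts
      in C′ , ts′ , Equivalence.from (elim-sat φ (tracks-⇒co tr ts′)) sat′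

  -- From `ℒEq` to `ℒCanco`

  extend₁ : ∀ {n} → Pred (Fin n) 0ℓ → Pred (Fin (suc n)) 0ℓ
  extend₁ A zero    = ⊥
  extend₁ A (suc x) = A x

  extend₂ : ∀ {n} → Rel (Fin n) 0ℓ → Rel (Fin (suc n)) 0ℓ
  extend₂ R (suc x) (suc y) = R x y
  extend₂ R _       _       = ⊥

  -- Boolean subsets, because `⋁` needs an index type in `Set`, whereas predicates on `Fin n` form a
  -- type in `Set₁`.
  Nonempty : ℕ → Set
  Nonempty n = Σ (Fin n → Bool) λ b → Satisfiable (T ∘ b)

  _∪²_ : ∀ {n} → Rel (Fin n) 0ℓ → Pred (Fin n) 0ℓ → Rel (Fin n) 0ℓ
  (R ∪² K) x y = R x y ⊎ (x ∈ K × y ∈ K)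

  commits : ∀ {n} → List (Nonempty n) → (Rel (Fin n) 0ℓ → Pure ℒCanco n) →
            Rel (Fin n) 0ℓ → Pure ℒCanco n
  commits []              ψ R = ⟨τ⟩ ψ R
  commits ((b , ne) ∷ bs) ψ R = ⟨co (T ∘ b) ∣ ne ⟩ commits bs ψ (R ∪² (T ∘ b))

  weakly : ∀ {n} → (Rel (Fin n) 0ℓ → Pure ℒCanco n) → Rel (Fin n) 0ℓ → Pure ℒCanco n
  weakly ψ R = ⋁ (List (Nonempty _)) λ bs → commits bs ψ R

  -- R is the relation =co on the variables in the current configuration.
  toCanco : ∀ {n} → Pure ℒEq n → Rel (Fin n) 0ℓ → Pure ℒCanco n
  toCanco (⟨τ⟩ φ)      R = weakly (toCanco φ) R
  toCanco (⟨x⟨ a ⟩⟩ φ) R = weakly (λ R′ → ⟨x⟨ a ⟩⟩ weakly (toCanco φ) (extend₂ R′)) R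
  toCanco (∼ φ)        R = ∼ toCanco φ R
  toCanco (⋀ M φ)      R = ⋀ M λ i → toCanco (φ i) R
  toCanco (x =co y)    R = ⋁ (R x y) λ _ → ⊤ᶠ

  Knows₂ : ∀ {n} → Rel (Fin n) 0ℓ → Vec exTrN n → Config → Set
  Knows₂ R ρ C = ∀ x y → R x y ⇔ CoEq C (lookup ρ x) (lookup ρ y)

  module _ {n} {R : Rel (Fin n) 0ℓ} {ρ : Vec exTrN n} where

    knows₂-step : ∀ {C D ζ} → Tracks ρ C → Knows₂ R ρ C → C —[ ζ ]→⟨ c ⟩ D →
                  (∀ k → k ∉ committedBy ζ) → Knows₂ R ρ D
    knows₂-step tr kn t none x y = mk⇔
      (λ r → CoEq-mono t (Equivalence.to (kn x y) r))
      (λ F → Equivalence.from (kn x y)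
        (Sum.[ id , (λ (k∈ , _) → ⊥-elim (none _ k∈)) ] (CoEq-new (sound tr) t F)))

    knows₂-steps : ∀ {C D} → Tracks ρ C → Knows₂ R ρ C → C =[τ]⇒⟨ c ⟩ D → Knows₂ R ρ D
    knows₂-steps tr kn []       = kn
    knows₂-steps tr kn (t ◅ ts) =
      knows₂-steps (tracks-step tr t λ _ ()) (knows₂-step tr kn t λ _ ()) ts

    knows₂-co : ∀ {C D K} (A : Pred (Fin n) 0ℓ) → Tracks ρ C → Knows₂ R ρ C → C —[ co K ]→⟨ c ⟩ D →
                (∀ x → x ∈ A ⇔ lookup ρ x ∈ K) → Knows₂ (R ∪² A) ρ D
    knows₂-co A tr kn t A⇔K x y = mk⇔
      Sum.[ (λ r → CoEq-mono t (Equivalence.to (kn x y) r))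
          , (λ (x∈ , y∈) → CoEq-co (sound tr) t (Equivalence.to (A⇔K x) x∈)
                                                (Equivalence.to (A⇔K y) y∈)) ]
      (λ F → Sum.map (Equivalence.from (kn x y))
                     (λ (x∈ , y∈) → Equivalence.from (A⇔K x) x∈ , Equivalence.from (A⇔K y) y∈)
                     (CoEq-new (sound tr) t F))

    -- A name just introduced was absent from the history, and a visible step commits nothing. So
    -- the new variable is related to no variable, not even to itself.
    knows₂-act : ∀ {C D l a} → Tracks ρ C → Knows₂ R ρ C → C —[ l ⟨ a ⟩ ]→⟨ c ⟩ D →
                 Knows₂ (extend₂ R) (l ∷ ρ) D
    knows₂-act {C} {D} {l} tr kn t = λ
      { zero    y       → mk⇔ (λ ()) λ F → unknown (proj₁ (proj₁ (old F)))
      ; (suc x) zero    → mk⇔ (λ ()) λ F → unknown (proj₂ (proj₁ (old F)))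
      ; (suc x) (suc y) → knows₂-step tr kn t (λ _ ()) x y
      }
      where
      old : ∀ {k k′} → CoEq D k k′ → CoEq C k k′
      old F with inj₁ F ← CoEq-new (sound tr) t F = F
      unknown : ∀ {X : Set} → l ∈ Hasco (H C) → X
      unknown l∈ = ⊥-elim (proj₂ (introduced t) (Hasco⊆Hᵗʳⁿ l∈))

  -- Injectivity of `ρ` ensures that passing to names and back adds no variables to `A`.
  valueₛ-vars : ∀ {n} {ρ : Vec exTrN n} {C} → Tracks ρ C → ∀ A x →
                x ∈ A ⇔ lookup ρ x ∈ valueₛ ρ (vars A)
  valueₛ-vars tr A x = mk⇔
    (λ x∈ → inj₂ x , x∈ , refl)
    (λ { (inj₂ y , y∈ , eq) → subst (_∈ A) (injective tr eq) y∈ })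

  -- Either shape of `commits` begins with a weak modality, which absorbs the silent step.
  commits-prefix : ∀ {n ψ R} {ρ : Vec exTrN n} bs {C D} → C —[ τ ]→⟨ c ⟩ D →
                   D ⊨[ ρ ] ⌊ commits bs ψ R ⌋ → C ⊨[ ρ ] ⌊ commits bs ψ R ⌋
  commits-prefix []       t (C′ , ts , sat)                = C′ , t ◅ ts , sat
  commits-prefix (_ ∷ bs) t (C′ , (D , D′ , ts , us) , sat) = C′ , (D , D′ , t ◅ ts , us) , sat

  -- The assumption on `ψ` quantifies over all correct `R′`, because the relation reached depends on
  -- the commits met along the run.
  commits⁺ : ∀ {n} {ψ : Rel (Fin n) 0ℓ → Pure ℒCanco n} {R} {ρ : Vec exTrN n} {C C′} →
             Tracks ρ C → Knows₂ R ρ C → C =[τ]⇒⟨ e ⟩ C′ →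
             (∀ {R′} → Knows₂ R′ ρ C′ → C′ ⊨[ ρ ] ⌊ ψ R′ ⌋) →
             ∃[ bs ] C ⊨[ ρ ] ⌊ commits bs ψ R ⌋
  commits⁺ tr kn [] sat = [] , _ , [] , sat kn
  commits⁺ {n} {ψ} {R} {ρ} {C} tr kn (t ◅ ts) sat with e-step t
  ... | inj₁ t =
    let bs , sat′ = commits⁺ {ψ = ψ} (tracks-step tr t λ _ ()) (knows₂-step tr kn t λ _ ()) ts sat
    in bs , commits-prefix bs t sat′
  ... | inj₂ (K , t) = ((b , ne) ∷ proj₁ rest) , _ , (_ , _ , [] , relabel K≐ t , []) , proj₂ rest
    where
    -- The label `K` is an arbitrary predicate; excluded middle turns it into a Boolean subset of
    -- the variables, and `covers` ensures that no name of `K` is lost.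
    b : Fin n → Bool
    b x = isYes (em₀ {lookup ρ x ∈ K})
    b⇔K : ∀ x → T (b x) ⇔ lookup ρ x ∈ K
    b⇔K x = mk⇔ toWitness fromWitness
    ne : Satisfiable (T ∘ b)
    ne with k , k∈ ← co-satisfiable t with x , refl ← covers tr (co-named t k∈) =
      x , Equivalence.from (b⇔K x) k∈
    K≐ : K ≐ valueₛ ρ (vars (T ∘ b))
    K≐ = (λ k∈ → let x , eq = covers tr (co-named t k∈) in
            inj₂ x , Equivalence.from (b⇔K x) (subst (_∈ K) (≡.sym eq) k∈) , eq) ,
         (λ { (inj₂ x , x∈ , refl) → Equivalence.to (b⇔K x) x∈ })
    rest = commits⁺ {ψ = ψ} (tracks-step tr t λ _ ()) (knows₂-co (T ∘ b) tr kn t b⇔K) ts sat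

  commits⁻ : ∀ {n} {ψ : Rel (Fin n) 0ℓ → Pure ℒCanco n} {R} {ρ : Vec exTrN n} bs {C} →
             Tracks ρ C → Knows₂ R ρ C → C ⊨[ ρ ] ⌊ commits bs ψ R ⌋ →
             ∃[ C′ ] ∃[ R′ ] C =[τ]⇒⟨ e ⟩ C′ × Knows₂ R′ ρ C′ × C′ ⊨[ ρ ] ⌊ ψ R′ ⌋
  commits⁻ [] tr kn (C′ , ts , sat) = C′ , _ , c-steps ts , knows₂-steps tr kn ts , sat
  commits⁻ {ψ = ψ} ((b , _) ∷ bs) tr kn (_ , (_ , _ , ts , t , us) , sat) =
    let tr₁ = tracks-steps tr ts
        tr₂ = tracks-step tr₁ t λ _ ()
        kn₂ = knows₂-co (T ∘ b) tr₁ (knows₂-steps tr kn ts) t (valueₛ-vars tr₁ (T ∘ b))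
        C′ , R′ , vs , kn′ , sat′ =
          commits⁻ {ψ = ψ} bs (tracks-steps tr₂ us) (knows₂-steps tr₂ kn₂ us) sat
    in C′ , R′ , c-steps ts ◅◅ co-step t ◅ c-steps us ◅◅ vs , kn′ , sat′

  toCanco-sat : ∀ {n} (φ : Pure ℒEq n) {R} {ρ : Vec exTrN n} {C} → Tracks ρ C → Knows₂ R ρ C →
                C ⊨[ ρ ] ⌊ φ ⌋ ⇔ C ⊨[ ρ ] ⌊ toCanco φ R ⌋
  weakly-toCanco⁺ : ∀ {n} (φ : Pure ℒEq n) {R} {ρ : Vec exTrN n} {C C′} →
                    Tracks ρ C → Knows₂ R ρ C → C =[τ]⇒⟨ e ⟩ C′ → C′ ⊨[ ρ ] ⌊ φ ⌋ →
                    C ⊨[ ρ ] ⌊ weakly (toCanco φ) R ⌋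
  weakly-toCanco⁺ φ tr kn ts sat =
    let bs , sat′ = commits⁺ {ψ = toCanco φ} tr kn ts
                      (λ kn′ → Equivalence.to (toCanco-sat φ (tracks-steps tr ts) kn′) sat)
    in some⁺ bs sat′
  weakly-toCanco⁻ : ∀ {n} (φ : Pure ℒEq n) {R} {ρ : Vec exTrN n} {C} →
                    Tracks ρ C → Knows₂ R ρ C → C ⊨[ ρ ] ⌊ weakly (toCanco φ) R ⌋ →
                    ∃[ C′ ] C =[τ]⇒⟨ e ⟩ C′ × C′ ⊨[ ρ ] ⌊ φ ⌋
  weakly-toCanco⁻ φ tr kn sat =
    let bs , sat′ = some⁻ sat
        C′ , _ , ts , kn′ , sat″ = commits⁻ {ψ = toCanco φ} bs tr kn sat′
    in C′ , ts , Equivalence.from (toCanco-sat φ (tracks-steps tr ts) kn′) sat″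

  toCanco-sat (⟨τ⟩ φ) tr kn = mk⇔
    (λ (_ , ts , sat) → weakly-toCanco⁺ φ tr kn ts sat)
    (weakly-toCanco⁻ φ tr kn)
  toCanco-sat (⟨x⟨ a ⟩⟩ φ) {R} {ρ} {C} tr kn = mk⇔ to from
    where
    ψ : Rel (Fin _) 0ℓ → Pure ℒCanco _
    ψ R′ = ⟨x⟨ a ⟩⟩ weakly (toCanco φ) (extend₂ R′)
    to : C ⊨[ ρ ] ⌊ ⟨x⟨ a ⟩⟩ φ ⌋ → C ⊨[ ρ ] ⌊ weakly ψ R ⌋
    -- Only one name is inspected: it fixes `D`, and with it the commits before the action. From
    -- this `D` the modality then holds for all fresh names by `some⇒⟨x⟩`.
    to sat with l , C′ , (D , D′ , ts , t , us) , sat′ ← ⟨x⟩⇒some ⌊ φ ⌋ {ρ} {C} sat =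
      let trD = tracks-steps tr ts
          bs , sat″ = commits⁺ {ψ = ψ} tr kn ts λ {R′} kn′ →
            some⇒⟨x⟩ (weakly (toCanco φ) (extend₂ R′)) trD (D , D′ , [] , act-step t , [])
              (weakly-toCanco⁺ φ (tracks-act trD t) (knows₂-act trD kn′ (act-step t)) us sat′)
      in some⁺ bs sat″
    from : C ⊨[ ρ ] ⌊ weakly ψ R ⌋ → C ⊨[ ρ ] ⌊ ⟨x⟨ a ⟩⟩ φ ⌋
    from sat =
      let bs , sat₁ = some⁻ sat
          D , R′ , ts , knD , sat₂ = commits⁻ {ψ = ψ} bs tr kn sat₁
          trD = tracks-steps tr ts
          l , D₃ , (D₁ , D₂ , us , t , vs) , sat₃ =
            ⟨x⟩⇒some ⌊ weakly (toCanco φ) (extend₂ R′) ⌋ {ρ} {D} sat₂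
          tr₁ = tracks-steps trD us
          tr₂ = tracks-act tr₁ t
          kn₃ = knows₂-steps tr₂ (knows₂-act tr₁ (knows₂-steps trD knD us) t) vs
          C′ , ws , sat₄ = weakly-toCanco⁻ φ (tracks-steps tr₂ vs) kn₃ sat₃
      in some⇒⟨x⟩ φ tr (D₁ , D₂ , ts ◅◅ c-steps us , act-step t , c-steps vs ◅◅ ws) sat₄
  toCanco-sat (∼ φ) tr kn = mk⇔
    (λ unsat sat → unsat (Equivalence.from (toCanco-sat φ tr kn) sat))
    (λ unsat sat → unsat (Equivalence.to (toCanco-sat φ tr kn) sat))
  toCanco-sat (⋀ M φ) tr kn = mk⇔
    (λ sat i → Equivalence.to (toCanco-sat (φ i) tr kn) (sat i))
    (λ sat i → Equivalence.from (toCanco-sat (φ i) tr kn) (sat i))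
  toCanco-sat (x =co y) tr kn = mk⇔
    (λ (lift F) → some⁺ (Equivalence.from (kn x y) F) λ ())
    (λ sat → lift (Equivalence.to (kn x y) (proj₁ (some⁻ sat))))

  -- From `ℒCanco` to `ℒHasco`

  exactly : ∀ {n} → Pred (Fin n) 0ℓ → Pure ℒHasco n
  exactly A = ⋀ (∃[ x ] x ∈ A) (λ (x , _) → hasco x) ∧ ⋀ (∃[ x ] x ∉ A) (λ (x , _) → ∼ hasco x)

  partly : ∀ {n} → Pred (Fin n) 0ℓ → Pure ℒHasco n
  partly K = ⋁ ((∃[ x ] x ∈ K) × (∃[ y ] y ∈ K)) λ ((x , _) , (y , _)) → hasco x ∧ ∼ hasco y

  -- A is the set of variables with committed names.  If a run from a configuration commits K, and no run from
  -- it can commit K only in part, then its first commit of external names commits all of K at once.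
  toHasco : ∀ {n} → Pure ℒCanco n → Pred (Fin n) 0ℓ → Pure ℒHasco n
  toHasco (⟨τ⟩ φ)      A = ⟨τ⟩ (exactly A ∧ toHasco φ A)
  toHasco (⟨x⟨ a ⟩⟩ φ) A = ⟨x⟨ a ⟩⟩ (exactly (extend₁ A) ∧ toHasco φ (extend₁ A))
  toHasco (∼ φ)        A = ∼ toHasco φ A
  toHasco (⋀ M φ)      A = ⋀ M λ i → toHasco (φ i) A
  toHasco (⟨co K ∣ _ ⟩ φ) A =
    ⟨τ⟩ (exactly A
      ∧ ⋀ (∃[ x ] x ∈ K) (λ (x , _) → ∼ hasco x)
      ∧ (∼ ⟨τ⟩ partly K)
      ∧ ⟨τ⟩ (exactly (A ∪ K) ∧ toHasco φ (A ∪ K)))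

  Knows₁ : ∀ {n} → Pred (Fin n) 0ℓ → Vec exTrN n → Config → Set
  Knows₁ A ρ C = ∀ x → x ∈ A ⇔ lookup ρ x ∈ Hasco (H C)

  exactly⁺ : ∀ {n A} (ρ : Vec exTrN n) C → Knows₁ A ρ C → C ⊨[ ρ ] ⌊ exactly A ⌋
  exactly⁺ ρ C kn = both
    (λ (x , x∈) → lift (Equivalence.to (kn x) x∈))
    (λ (x , x∉) (lift k∈) → x∉ (Equivalence.from (kn x) k∈))

  exactly⁻ : ∀ {n A} (ρ : Vec exTrN n) C → C ⊨[ ρ ] ⌊ exactly A ⌋ → Knows₁ A ρ C
  exactly⁻ ρ C sat x = mk⇔
    (λ x∈ → lower (sat true (x , x∈)))
    (λ k∈ → decidable-stable em₀ λ x∉ → sat false (x , x∉) (lift k∈))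

  knows₁-⊆ : ∀ {n A} {ρ : Vec exTrN n} C {D} → Tracks ρ D → Knows₁ A ρ C → Knows₁ A ρ D →
             Hasco (H D) ⊆ Hasco (H C)
  knows₁-⊆ C tr knC knD k∈ with x , refl ← covers tr (Hasco⊆Hᵗʳⁿ k∈) =
    Equivalence.to (knC x) (Equivalence.from (knD x) k∈)

  knows₁-steps : ∀ {n A} (ρ : Vec exTrN n) {C D} → Knows₁ A ρ C → C =[τ]⇒⟨ c ⟩ D → Knows₁ A ρ D
  knows₁-steps ρ kn ts x = mk⇔
    (λ x∈ → steps-committed ts (Equivalence.to (kn x) x∈))
    (λ k∈ → Equivalence.from (kn x) (c-steps-committed ts k∈))

  -- An observed commit is of a nonempty set, by `Sound` its names were uncommitted before and are
  -- committed after, and they remain so to the end of the run. A run without a net change therefore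
  -- contains no such commit.
  quiet : ∀ {C D} → Sound C → C =[τ]⇒⟨ e ⟩ D → Hasco (H D) ⊆ Hasco (H C) → C =[τ]⇒⟨ c ⟩ D
  quiet sound [] old = []
  quiet sound (t ◅ ts) old with e-step t
  ... | inj₁ t′ = t′ ◅ quiet (—→-sound t sound) ts (λ k∈ → committed-mono t (old k∈))
  ... | inj₂ (K , t′) with k , k∈ ← co-satisfiable t′ =
    ⊥-elim (co-uncommitted t′ sound k∈ (old (steps-committed ts (co-committed t′ sound k∈))))

  first-commit : ∀ {C D} {K : Pred exTrN 0ℓ} → Sound C → C =[τ]⇒⟨ e ⟩ D → Satisfiable K →
                 (∀ {k} → k ∈ K → k ∉ Hasco (H C)) → K ⊆ Hasco (H D) →
                 (∀ {k} → k ∈ Hasco (H D) → k ∈ Hasco (H C) ⊎ k ∈ K) →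
                 (∀ {C′} → C =[τ]⇒⟨ e ⟩ C′ →
                   ∀ {k l} → k ∈ K → l ∈ K → k ∈ Hasco (H C′) → l ∈ Hasco (H C′)) →
                 C =[ co K ]⇒⟨ c ⟩ D
  first-commit sound [] (k , k∈) unc com split whole = ⊥-elim (unc k∈ (com k∈))
  first-commit {C} {K = K} sound (_◅_ {j = C₁} t ts) (k , k∈) unc com split whole with e-step t
  ... | inj₁ t′ = prefix (first-commit (—→-sound t sound) ts (k , k∈)
                    (λ k∈ k∈₁ → unc k∈ (old k∈₁)) com
                    (λ k∈ → Sum.map₁ (committed-mono t) (split k∈))
                    (λ us → whole (t ◅ us)))
    where
    old : Hasco (H C₁) ⊆ Hasco (H C)
    old k∈ with inj₁ k∈ ← committed-new t′ k∈ = k∈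
    prefix : ∀ {D} → C₁ =[ co K ]⇒⟨ c ⟩ D → C =[ co K ]⇒⟨ c ⟩ D
    prefix (_ , _ , us , u , vs) = _ , _ , t′ ◅ us , u , vs
  ... | inj₂ (K₁ , t′) = _ , _ , [] , relabel (K₁⊆K , K⊆K₁) t′ ,
                         quiet (—→-sound t sound) ts
                           (λ k∈ → Sum.[ committed-mono t , K⊆C₁ ] (split k∈))
    where
    K₁⊆K : K₁ ⊆ K
    K₁⊆K k∈₁ with split (steps-committed ts (co-committed t′ sound k∈₁))
    ... | inj₁ k∈C = ⊥-elim (co-uncommitted t′ sound k∈₁ k∈C)
    ... | inj₂ k∈  = k∈
    K⊆C₁ : K ⊆ Hasco (H C₁)
    K⊆C₁ l∈ with m , m∈ ← co-satisfiable t′ =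
      whole (t ◅ []) (K₁⊆K m∈) l∈ (co-committed t′ sound m∈)
    K⊆K₁ : K ⊆ K₁
    K⊆K₁ l∈ with committed-new t′ (K⊆C₁ l∈)
    ... | inj₁ l∈C = ⊥-elim (unc l∈ l∈C)
    ... | inj₂ l∈₁ = l∈₁

  toHasco-sat : ∀ {n} (φ : Pure ℒCanco n) {A} {ρ : Vec exTrN n} {C} → Tracks ρ C → Knows₁ A ρ C →
                C ⊨[ ρ ] ⌊ φ ⌋ ⇔ C ⊨[ ρ ] ⌊ toHasco φ A ⌋
  toHasco-sat (⟨τ⟩ φ) {A} {ρ} {C} tr kn = mk⇔
    (λ (C′ , ts , sat) → let kn′ = knows₁-steps ρ kn ts in
      C′ , c-steps ts ,
      both (exactly⁺ ρ C′ kn′) (Equivalence.to (toHasco-sat φ (tracks-steps tr ts) kn′) sat))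
    (λ (C′ , ts , sat) → let kn′ = exactly⁻ ρ C′ (sat true); tr′ = tracks-steps tr ts in
      C′ , quiet (sound tr) ts (knows₁-⊆ C tr′ kn kn′) ,
      Equivalence.from (toHasco-sat φ tr′ kn′) (sat false))
  toHasco-sat {n} (⟨x⟨ a ⟩⟩ φ) {A} {ρ} {C} tr kn = mk⇔ to from
    where
    A⁺ : Pred (Fin (suc n)) 0ℓ
    A⁺ = extend₁ A
    to : C ⊨[ ρ ] ⌊ ⟨x⟨ a ⟩⟩ φ ⌋ → C ⊨[ ρ ] ⌊ toHasco (⟨x⟨ a ⟩⟩ φ) A ⌋
    to (excl , sat) = excl , λ l l∉ → step l (sat l l∉)
      where
      step : ∀ l → ∃[ C′ ] C =[ l ⟨ a ⟩ ]⇒⟨ c ⟩ C′ × C′ ⊨[ l ∷ ρ ] ⌊ φ ⌋ →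
             ∃[ C′ ] C =[ l ⟨ a ⟩ ]⇒⟨ e ⟩ C′ × C′ ⊨[ l ∷ ρ ] ⌊ exactly A⁺ ∧ toHasco φ A⁺ ⌋
      step l (C′ , ts′@(D , D′ , ts , t , us) , sat′) =
        C′ , (D , D′ , c-steps ts , act-step t , c-steps us) ,
        both (exactly⁺ (l ∷ ρ) C′ kn′) (Equivalence.to (toHasco-sat φ (tracks-⇒act tr ts′) kn′) sat′)
        where
        old : Hasco (H D′) ⊆ Hasco (H D)
        old k∈ with inj₁ k∈ ← committed-new t k∈ = k∈
        knD′ : Knows₁ A⁺ (l ∷ ρ) D′
        knD′ zero    = mk⇔ (λ ()) λ l∈ → proj₂ (introduced t) (Hasco⊆Hᵗʳⁿ (old l∈))
        knD′ (suc x) = mk⇔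
          (λ x∈ → committed-mono t (Equivalence.to (knows₁-steps ρ kn ts x) x∈))
          (λ k∈ → Equivalence.from (knows₁-steps ρ kn ts x) (old k∈))
        kn′ : Knows₁ A⁺ (l ∷ ρ) C′
        kn′ = knows₁-steps (l ∷ ρ) knD′ us
    from : C ⊨[ ρ ] ⌊ toHasco (⟨x⟨ a ⟩⟩ φ) A ⌋ → C ⊨[ ρ ] ⌊ ⟨x⟨ a ⟩⟩ φ ⌋
    from (excl , sat) = excl , λ l l∉ → step l (sat l l∉)
      where
      step : ∀ l →
             ∃[ C′ ] C =[ l ⟨ a ⟩ ]⇒⟨ e ⟩ C′ × C′ ⊨[ l ∷ ρ ] ⌊ exactly A⁺ ∧ toHasco φ A⁺ ⌋ →
             ∃[ C′ ] C =[ l ⟨ a ⟩ ]⇒⟨ c ⟩ C′ × C′ ⊨[ l ∷ ρ ] ⌊ φ ⌋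
      step l (C′ , ts′@(D , D′ , ts , t , us) , sat′) =
        C′ , (D , D′ , quiet (sound tr) ts (λ k∈ → old (after (committed-mono t k∈))) , act-step t ,
              quiet (—→-sound t (sound (tracks-steps tr ts))) us
                (λ k∈ → committed-mono t (steps-committed ts (old k∈)))) ,
        Equivalence.from (toHasco-sat φ tr′ kn′) (sat′ false)
        where
        tr′ = tracks-⇒act tr ts′
        kn′ = exactly⁻ (l ∷ ρ) C′ (sat′ true)
        after : Hasco (H D′) ⊆ Hasco (H C′)
        after = steps-committed us
        old : Hasco (H C′) ⊆ Hasco (H C)
        old k∈ with covers tr′ (Hasco⊆Hᵗʳⁿ k∈)
        -- `extend₁ A` omits the new variable, so the guard `exactly` denies that `l` is committed
        -- at the end. All committed names are thus old ones, and both halves of the run are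
        -- `quiet`.
        ... | zero  , refl = ⊥-elim (Equivalence.from (kn′ zero) k∈)
        ... | suc x , refl = Equivalence.to (kn x) (Equivalence.from (kn′ (suc x)) k∈)
  toHasco-sat (∼ φ) tr kn = mk⇔
    (λ unsat sat → unsat (Equivalence.from (toHasco-sat φ tr kn) sat))
    (λ unsat sat → unsat (Equivalence.to (toHasco-sat φ tr kn) sat))
  toHasco-sat (⋀ M φ) tr kn = mk⇔
    (λ sat i → Equivalence.to (toHasco-sat (φ i) tr kn) (sat i))
    (λ sat i → Equivalence.from (toHasco-sat (φ i) tr kn) (sat i))
  toHasco-sat {n} (⟨co K ∣ x₀ , x₀∈ ⟩ φ) {A} {ρ} {C} tr kn = mk⇔ to from
    where
    N : Pred exTrN 0ℓ
    N = valueₛ ρ (vars K)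
    K⇔N : ∀ x → x ∈ K ⇔ lookup ρ x ∈ N
    K⇔N = valueₛ-vars tr K
    to : C ⊨[ ρ ] ⌊ ⟨co K ∣ x₀ , x₀∈ ⟩ φ ⌋ →
         C ⊨[ ρ ] ⌊ toHasco (⟨co K ∣ x₀ , x₀∈ ⟩ φ) A ⌋
    to (C′ , ts′@(D , D′ , ts , t , us) , sat) =
      -- The witness is the configuration right before the commit. There the names of `K` are
      -- already related by `E`, as `whole` requires; at `C` they need not be.
      D , c-steps ts ,
      both (exactly⁺ ρ D knD) (both uncommitted (both whole
        (C′ , co-step t ◅ c-steps us ,
         both (exactly⁺ ρ C′ kn′) (Equivalence.to (toHasco-sat φ (tracks-⇒co tr ts′) kn′) sat))))
      where
      soundD : Sound D
      soundD = sound (tracks-steps tr ts)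
      knD : Knows₁ A ρ D
      knD = knows₁-steps ρ kn ts
      knD′ : Knows₁ (A ∪ K) ρ D′
      knD′ x = mk⇔
        Sum.[ (λ x∈ → committed-mono t (Equivalence.to (knD x) x∈))
            , (λ x∈ → co-committed t soundD (Equivalence.to (K⇔N x) x∈)) ]
        (λ k∈ → Sum.map (Equivalence.from (knD x)) (Equivalence.from (K⇔N x)) (committed-new t k∈))
      kn′ : Knows₁ (A ∪ K) ρ C′
      kn′ = knows₁-steps ρ knD′ us
      uncommitted : D ⊨[ ρ ] ⌊ ⋀ (∃[ x ] x ∈ K) (λ (x , _) → ∼ hasco x) ⌋
      uncommitted (x , x∈) (lift k∈) = co-uncommitted t soundD (Equivalence.to (K⇔N x) x∈) k∈
      whole : D ⊨[ ρ ] ⌊ ∼ ⟨τ⟩ partly K ⌋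
      whole (D″ , vs , sat) with ((x , x∈) , (y , y∈)) , sat′ ← some⁻ sat =
        sat′ false (lift (Equivalence.to (E-Hasco D″ F) (lower (sat′ true))))
        where
        F : E D″ (ext (lookup ρ x)) (ext (lookup ρ y))
        F = steps-E vs (co-related t (Equivalence.to (K⇔N x) x∈) (Equivalence.to (K⇔N y) y∈))
    from : C ⊨[ ρ ] ⌊ toHasco (⟨co K ∣ x₀ , x₀∈ ⟩ φ) A ⌋ →
           C ⊨[ ρ ] ⌊ ⟨co K ∣ x₀ , x₀∈ ⟩ φ ⌋
    -- The Booleans select conjuncts of the right-nested `_∧_`: `true` the left one, `false` the
    -- right one.
    from (D , ts , sat) with C′ , us , sat′ ← sat false false false =
      C′ , prefix commit-K , Equivalence.from (toHasco-sat φ tr′ kn′) (sat′ false)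
      where
      trD : Tracks ρ D
      trD = tracks-steps tr ts
      tr′ : Tracks ρ C′
      tr′ = tracks-steps trD us
      knD : Knows₁ A ρ D
      knD = exactly⁻ ρ D (sat true)
      kn′ : Knows₁ (A ∪ K) ρ C′
      kn′ = exactly⁻ ρ C′ (sat′ true)
      committed-old : ∀ {k} → k ∈ Hasco (H C′) → k ∈ Hasco (H D) ⊎ k ∈ N
      committed-old k∈ with x , refl ← covers tr′ (Hasco⊆Hᵗʳⁿ k∈) =
        Sum.map (Equivalence.to (knD x)) (Equivalence.to (K⇔N x)) (Equivalence.from (kn′ x) k∈)
      whole : ∀ {D′} → D =[τ]⇒⟨ e ⟩ D′ →
              ∀ {k l} → k ∈ N → l ∈ N → k ∈ Hasco (H D′) → l ∈ Hasco (H D′)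
      whole vs (inj₂ x , x∈ , refl) (inj₂ y , y∈ , refl) k∈ = decidable-stable em₀ λ l∉ →
        sat false false true
          (_ , vs , some⁺ ((x , x∈) , (y , y∈)) (both (lift k∈) (λ (lift l∈) → l∉ l∈)))
      commit-K : D =[ co N ]⇒⟨ c ⟩ C′
      commit-K = first-commit (sound trD) us (_ , inj₂ x₀ , x₀∈ , refl)
        (λ { (inj₂ x , x∈ , refl) k∈ → sat false true (x , x∈) (lift k∈) })
        (λ { (inj₂ x , x∈ , refl) → Equivalence.to (kn′ x) (inj₂ x∈) })
        committed-old whole
      prefix : D =[ co N ]⇒⟨ c ⟩ C′ → C =[ co N ]⇒⟨ c ⟩ C′
      prefix (_ , _ , vs , t , ws) =
        _ , _ , quiet (sound tr) ts (knows₁-⊆ C trD kn knD) ◅◅ vs , t , ws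

  -- From `ℒHasco` to `ℒEq`

  toEq : ∀ {n} → Formula ℒHasco n → Formula ℒEq n
  toEq (⟨τ⟩ φ)      = ⟨τ⟩ toEq φ
  toEq (⟨x⟨ a ⟩⟩ φ) = ⟨x⟨ a ⟩⟩ toEq φ
  toEq (∼ φ)        = ∼ toEq φ
  toEq (⋀ M φ)      = ⋀ M λ i → toEq (φ i)
  toEq (hasco v)    = v =co v

  -- Both logics are interpreted over `e`, so only the atoms matter: a committed name is in the
  -- history, and by `E-H` the relation `E` is reflexive there.
  toEq-sat : ∀ {n} (φ : Formula ℒHasco n) {ρ C} → C ⊨[ ρ ] φ ⇔ C ⊨[ ρ ] toEq φ
  toEq-sat (⟨τ⟩ φ) = mk⇔
    (λ (C′ , ts , sat) → C′ , ts , Equivalence.to (toEq-sat φ) sat)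
    (λ (C′ , ts , sat) → C′ , ts , Equivalence.from (toEq-sat φ) sat)
  toEq-sat (⟨x⟨ a ⟩⟩ φ) = mk⇔
    (λ (excl , sat) → excl , λ l l∉ → let C′ , ts , sat′ = sat l l∉ in
      C′ , ts , Equivalence.to (toEq-sat φ) sat′)
    (λ (excl , sat) → excl , λ l l∉ → let C′ , ts , sat′ = sat l l∉ in
      C′ , ts , Equivalence.from (toEq-sat φ) sat′)
  toEq-sat (∼ φ) = mk⇔
    (λ unsat sat → unsat (Equivalence.from (toEq-sat φ) sat))
    (λ unsat sat → unsat (Equivalence.to (toEq-sat φ) sat))
  toEq-sat (⋀ M φ) = mk⇔
    (λ sat i → Equivalence.to (toEq-sat (φ i)) (sat i))
    (λ sat i → Equivalence.from (toEq-sat (φ i)) (sat i))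
  toEq-sat (hasco v) {C = C} = mk⇔
    (λ (lift k∈) → lift ((k∈ , k∈) , Equivalence.from (E-H C _) (Hasco⊆Hᵗʳⁿ k∈)))
    (λ (lift ((k∈ , _) , _)) → lift k∈)

  -- Processes as initial configurations, and the three comparisons

  initial : ∀ P → Tracks [] ⟨∅⨟ε• P ⟩
  initial P = record
    { sound     = λ { (_ , l∈ , inj₁ refl) → ⊥-elim (Process.internal-only P _ l∈) }
    ; covers    = λ { (_ , _ , ()) }
    ; named     = λ ()
    ; injective = λ { {()} }
    }

  Eq≼Canco : ℒEq ≼exp ℒCanco
  Eq≼Canco φ = ⌊ toCanco (elim φ []) (λ ()) ⌋ , λ P →
    toCanco-sat (elim φ []) (initial P) (λ ()) ⇔-∘ elim-sat φ (initial P)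

  Canco≼Hasco : ℒCanco ≼exp ℒHasco
  Canco≼Hasco φ = ⌊ toHasco (elim φ []) (λ ()) ⌋ , λ P →
    toHasco-sat (elim φ []) (initial P) (λ ()) ⇔-∘ elim-sat φ (initial P)

  Hasco≼Eq : ℒHasco ≼exp ℒEq
  Hasco≼Eq φ = toEq φ , λ P → toEq-sat φ

theorem6p9 : ExcludedMiddle (lsuc 0ℓ) → (S : Signature) → let open TCCS S in
    (ℒEq ≼exp ℒCanco) × (ℒCanco ≼exp ℒHasco) × (ℒHasco ≼exp ℒEq)
theorem6p9 em S = Eq≼Canco , Canco≼Hasco , Hasco≼Eq
  where open Translations em S
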